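{- For every $3$-partite graph $G$ (i.e. every graph whose vertex set can be partitioned into three independent sets), $$\vec{\chi}(G)\leq \left\lceil \frac{\text{Mad}(G)}{2} \right\rceil+7.$$
   Context: Graphs are finite and simple. A proper orientation $D$ of a graph $G$ is an orientation of the edges of $G$ such that $d_D^+(u)\neq d_D^+(v)$ for every edge $uv\in E(G)$, where $d_D^+$ denotes out-degree in $D$. The proper orientation number $\vec{\chi}(G)$ is the minimum of $\Delta^+(D)$ (the maximum out-degree of $D$) over all proper orientations $D$ of $G$. The maximum average degree is $\text{Mad}(G)=\max_{H\subseteq G} \frac{2|E(H)|}{|V(H)|}$, the maximum over all (nonempty) subgraphs $H$ of $G$. -}

module Defs where

open import Data.Bool using (Bool; true; false; T; if_then_else_; _∧_)
open import Data.Nat using (ℕ; zero; suc; _+_; _*_; _<ᵇ_)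
import Data.Fin
open import Data.Fin using (Fin; toℕ)
open import Data.Product using (Σ; ∃; _×_; _,_)
open import Data.Sum using (_⊎_)
open import Relation.Binary.PropositionalEquality using (_≡_; _≢_)
open import Relation.Nullary using (¬_)
open import Data.Integer using (ℤ; +_)
open import Data.Rational using (ℚ; _/_; _≤_) renaming (_*_ to _*ℚ_)

count : {n : ℕ} → (Fin n → Bool) → ℕ
count {zero}  f = 0
count {suc n} f = (if f Data.Fin.zero then 1 else 0) + count (λ i → f (Data.Fin.suc i))

record Graph (n : ℕ) : Set where
  field
    adj   : Fin n → Fin n → Bool
    sym   : ∀ u v → adj u v ≡ adj v u
    irrefl : ∀ v → adj v v ≡ false
open Graph public

Tripartite : {n : ℕ} → Graph n → Set
Tripartite {n} G = Σ (Fin n → Fin 3) λ c → ∀ u v → T (adj G u v) → c u ≢ c v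

record Orientation {n : ℕ} (G : Graph n) : Set where
  field
    arc      : Fin n → Fin n → Bool
    arc⊆adj  : ∀ u v → T (arc u v) → T (adj G u v)
    oneWay   : ∀ u v → T (arc u v) → ¬ T (arc v u)
    covers   : ∀ u v → T (adj G u v) → T (arc u v) ⊎ T (arc v u)
open Orientation public

outdeg : {n : ℕ} {G : Graph n} → Orientation G → Fin n → ℕ
outdeg D u = count (arc D u)

Proper : {n : ℕ} {G : Graph n} → Orientation G → Set
Proper {G = G} D = ∀ u v → T (adj G u v) → outdeg D u ≢ outdeg D v

record Subgraph {n : ℕ} (G : Graph n) : Set where
  field
    S     : Fin n → Bool
    F     : Fin n → Fin n → Bool
    Fsym  : ∀ u v → F u v ≡ F v u
    F⊆E   : ∀ u v → T (F u v) → T (adj G u v)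
    FinS  : ∀ u v → T (F u v) → T (S u)
open Subgraph public

nV : {n : ℕ} {G : Graph n} → Subgraph G → ℕ
nV H = count (S H)

nE : {n : ℕ} {G : Graph n} → Subgraph G → ℕ
nE H = sumOver (λ u → count (λ v → (toℕ u <ᵇ toℕ v) ∧ F H u v))
  where
  sumOver : ∀ {n} → (Fin n → ℕ) → ℕ
  sumOver {zero} g = 0
  sumOver {suc n} g = g Data.Fin.zero + sumOver (λ i → g (Data.Fin.suc i))

Nonempty : {n : ℕ} {G : Graph n} → Subgraph G → Set
Nonempty H = ∃ λ v → T (S H v)

ℕtoℚ : ℕ → ℚ
ℕtoℚ m = + m / 1

-- q = Mad(G) = max over nonempty subgraphs H of 2|E(H)|/|V(H)|
-- (ratios compared after multiplying by |V(H)| > 0).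
IsMad : {n : ℕ} → Graph n → ℚ → Set
IsMad G q =
  (Σ (Subgraph G) λ H → Nonempty H × (q *ℚ ℕtoℚ (nV H) ≡ ℕtoℚ (2 * nE H)))
  × (∀ (H : Subgraph G) → Nonempty H → ℕtoℚ (2 * nE H) ≤ q *ℚ ℕtoℚ (nV H))

module Submission where

-- Let k = ⌈Mad(G)/2⌉. By Hakimi's theorem there is an orientation with all
-- out-degrees at most k. Vertices are now settled one after another at values
-- d = k+7, k+6, …, 0, those with the same value forming an independent set.
-- The potential of an unsettled vertex is its out-degree plus the number of its
-- unsettled in-neighbours, i.e. the largest value it can still reach. Settling v
-- at d turns all but (potential of v) − d of the arcs coming from unsettled
-- vertices; every unsettled neighbour then loses one unit of potential, except for
-- the tails of the arcs kept, and no unsettled out-degree grows beyond k.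
-- Settling classes 2, 1, 0 at k+7, k+6, k+5 wherever possible leaves potentials at
-- most k+4, k+5, k+6 in classes 0, 1, 2. The four levels k+4, …, k+1 bring all
-- potentials down to k; they work because a vertex that cannot be settled safely
-- at such a level has almost all its in-neighbours settled there, so that its
-- potential falls to about its out-degree. From k downwards one settles greedily
-- the vertices of maximum potential.

open import Defs renaming (sym to adj-sym)
open import Data.Bool using (Bool; true; false; T; not; if_then_else_; _∧_; _∨_)
open import Data.Bool.Properties using (T-≡; ∧-comm; ∧-zeroʳ; ∧-identityʳ; ∨-identityʳ) renaming (_≟_ to _≟ᵇ_)
open import Data.Empty using (⊥-elim)
open import Data.Fin using (Fin; toℕ; _≟_)
open import Data.Fin.Patterns using (0F; 1F; 2F)
open import Data.Fin.Properties using (any?; toℕ-injective)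
open import Data.Nat using (ℕ; zero; suc; _<ᵇ_)
open import Data.Product using (Σ; ∃; _×_; _,_; proj₁; proj₂)
open import Data.Sum using (_⊎_; inj₁; inj₂)
open import Function using (_∘_; Equivalence)
open import Relation.Binary.PropositionalEquality using (_≡_; _≢_; refl; sym; trans; cong; cong₂; subst; subst₂; module ≡-Reasoning)
open import Relation.Nullary using (¬_; Dec; yes; no; does)
open import Relation.Nullary.Decidable using (_×-dec_; dec-true; dec-false)

-- Counting with Boolean predicates and finite sums

module Counting where
  open import Data.Nat using (_+_; _*_; _≤_; _<_; z≤n; s≤s; s≤s⁻¹)
  open import Data.Nat.Properties using (+-identityʳ; +-mono-≤; ≤-refl; ≤-reflexive; ≤-trans; m≤n⇒m≤1+n; *-cancelˡ-≡; +-0-commutativeMonoid)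
  open import Algebra.Properties.CommutativeMonoid.Sum +-0-commutativeMonoid public
    using (sum; sum-cong-≗; ∑-distrib-+; ∑-comm)

  T⇒≡ : ∀ {b} → T b → b ≡ true
  T⇒≡ = Equivalence.to T-≡

  ≡⇒T : ∀ {b} → b ≡ true → T b
  ≡⇒T = Equivalence.from T-≡

  ∧-elim : ∀ a {b} → a ∧ b ≡ true → a ≡ true × b ≡ true
  ∧-elim true eq = refl , eq

  ∧-intro : ∀ {a b} → a ≡ true → b ≡ true → a ∧ b ≡ true
  ∧-intro refl eq = eq

  true≢false : ∀ {b} {A : Set} → b ≡ true → b ≡ false → A
  true≢false refl ()

  ¬true⇒false : ∀ {b} → ¬ b ≡ true → b ≡ false
  ¬true⇒false {true} h = ⊥-elim (h refl)
  ¬true⇒false {false} _ = refl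

  𝟙 : Bool → ℕ
  𝟙 b = if b then 1 else 0

  count-cong : ∀ {n} {f g : Fin n → Bool} → (∀ i → f i ≡ g i) → count f ≡ count g
  count-cong {zero} h = refl
  count-cong {suc n} h = cong₂ _+_ (cong 𝟙 (h 0F)) (count-cong (h ∘ Fin.suc))

  count-none : ∀ {n} {f : Fin n → Bool} → (∀ i → f i ≡ false) → count f ≡ 0
  count-none {zero} h = refl
  count-none {suc n} h rewrite h 0F = count-none (h ∘ Fin.suc)

  count-mono : ∀ {n} {f g : Fin n → Bool} → (∀ i → f i ≡ true → g i ≡ true) → count f ≤ count g
  count-mono {zero} h = z≤n
  count-mono {suc n} {f} h = +-mono-≤ (𝟙-mono _ (h 0F)) (count-mono (h ∘ Fin.suc))
    where
    𝟙-mono : ∀ a {b} → (a ≡ true → b ≡ true) → 𝟙 a ≤ 𝟙 b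
    𝟙-mono false h = z≤n
    𝟙-mono true h rewrite h refl = ≤-refl

  count≤n : ∀ {n} (f : Fin n → Bool) → count f ≤ n
  count≤n {zero} f = z≤n
  count≤n {suc n} f with f 0F
  ... | true = s≤s (count≤n _)
  ... | false = m≤n⇒m≤1+n (count≤n _)

  count-sum : ∀ {n} (f : Fin n → Bool) → count f ≡ sum (𝟙 ∘ f)
  count-sum {zero} f = refl
  count-sum {suc n} f = cong (𝟙 (f 0F) +_) (count-sum (f ∘ Fin.suc))

  count-+ : ∀ {n} (f g : Fin n → Bool) {h : Fin n → Bool} →
    (∀ i → 𝟙 (f i) + 𝟙 (g i) ≡ 𝟙 (h i)) → count f + count g ≡ count h
  count-+ f g {h} eq = begin
    count f + count g            ≡⟨ cong₂ _+_ (count-sum f) (count-sum g) ⟩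
    sum (𝟙 ∘ f) + sum (𝟙 ∘ g)    ≡⟨ ∑-distrib-+ (𝟙 ∘ f) (𝟙 ∘ g) ⟨
    sum (λ i → 𝟙 (f i) + 𝟙 (g i)) ≡⟨ sum-cong-≗ eq ⟩
    sum (𝟙 ∘ h)                  ≡⟨ count-sum h ⟨
    count h                      ∎
    where open ≡-Reasoning

  is : ∀ {n} → Fin n → Fin n → Bool
  is v w = does (w ≟ v)

  is-refl : ∀ {n} (v : Fin n) → is v v ≡ true
  is-refl v = dec-true (v ≟ v) refl

  is-≢ : ∀ {n} {v w : Fin n} → w ≢ v → is v w ≡ false
  is-≢ {v = v} {w} = dec-false (w ≟ v)

  is⇒≡ : ∀ {n} (v w : Fin n) → is v w ≡ true → w ≡ v
  is⇒≡ v w eq with w ≟ v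
  ... | yes p = p

  count-is : ∀ {n} (v : Fin n) → count (is v) ≡ 1
  count-is {suc n} 0F = cong suc (count-none {n} (λ _ → refl))
  count-is (Fin.suc v) = trans (count-cong (λ w → does-suc w)) (count-is v)
    where
    does-suc : ∀ w → is (Fin.suc v) (Fin.suc w) ≡ is v w
    does-suc w with w ≟ v
    ... | yes refl = refl
    ... | no _ = refl

  count-∧-is : ∀ {n} b (v : Fin n) → count (λ w → b ∧ is v w) ≡ 𝟙 b
  count-∧-is true v = count-is v
  count-∧-is {n} false v = count-none {n} (λ _ → refl)

  count-pos : ∀ {n} (f : Fin n → Bool) {v} → f v ≡ true → 0 < count f
  count-pos f {v} fv = ≤-trans (≤-reflexive (sym (count-is v)))
    (count-mono (λ w w≡v → trans (cong f (is⇒≡ v w w≡v)) fv))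

  _∖_ : ∀ {n} → (Fin n → Bool) → Fin n → Fin n → Bool
  (f ∖ v) w = f w ∧ not (is v w)

  count-∖ : ∀ {n} (f : Fin n → Bool) {v} → f v ≡ true → count (f ∖ v) + 1 ≡ count f
  count-∖ f {v} fv = trans (cong (count (f ∖ v) +_) (sym (count-is v))) (count-+ (f ∖ v) (is v) pw)
    where
    pw : ∀ w → 𝟙 (f w ∧ not (is v w)) + 𝟙 (is v w) ≡ 𝟙 (f w)
    pw w with w ≟ v
    ... | yes refl rewrite fv = refl
    ... | no _ = trans (+-identityʳ _) (cong 𝟙 (∧-identityʳ (f w)))

  ∖-self : ∀ {n} (f : Fin n → Bool) v → (f ∖ v) v ≡ false
  ∖-self f v = trans (cong (λ b → f v ∧ not b) (is-refl v)) (∧-zeroʳ (f v))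

  ∖-other : ∀ {n} (f : Fin n → Bool) {v w} → w ≢ v → (f ∖ v) w ≡ f w
  ∖-other f {w = w} w≢v = trans (cong (λ b → f w ∧ not b) (is-≢ w≢v)) (∧-identityʳ (f w))

  ∖-elim : ∀ {n} (f : Fin n → Bool) {v w} → (f ∖ v) w ≡ true → f w ≡ true × w ≢ v
  ∖-elim f {v} {w} eq = proj₁ (∧-elim (f w) eq) , λ { refl → true≢false eq (∖-self f v) }

  sub-of-size : ∀ {n} (f : Fin n → Bool) m → m ≤ count f →
    Σ (Fin n → Bool) λ g → (∀ i → g i ≡ true → f i ≡ true) × count g ≡ m
  sub-of-size {n} f zero _ = (λ _ → false) , (λ _ ()) , count-none {n} (λ _ → refl)
  sub-of-size {suc n} f (suc m) le with f 0F in eq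
  ... | true with sub-of-size (f ∘ Fin.suc) m (s≤s⁻¹ le)
  ...   | g , g⊆f , size = (λ { 0F → true ; (Fin.suc i) → g i })
                         , (λ { 0F _ → eq ; (Fin.suc i) → g⊆f i })
                         , cong suc size
  sub-of-size {suc n} f (suc m) le | false with sub-of-size (f ∘ Fin.suc) (suc m) le
  ...   | g , g⊆f , size = (λ { 0F → false ; (Fin.suc i) → g i })
                         , (λ { (Fin.suc i) → g⊆f i })
                         , size

  sum-mono : ∀ {n} {f g : Fin n → ℕ} → (∀ i → f i ≤ g i) → sum f ≤ sum g
  sum-mono {zero} h = z≤n
  sum-mono {suc n} h = +-mono-≤ (h 0F) (sum-mono (h ∘ Fin.suc))

  -- Doubling each total and interchanging the order of summation in one of its two copies gives a
  -- sum of symmetrised terms over ordered pairs, where the hypothesis applies term by term.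
  double-count : ∀ {n} (a b : Fin n → Fin n → Bool) →
    (∀ u v → 𝟙 (a u v) + 𝟙 (a v u) ≡ 𝟙 (b u v) + 𝟙 (b v u)) →
    sum (λ u → count (a u)) ≡ sum (λ u → count (b u))
  double-count {n} a b eq = *-cancelˡ-≡ _ _ 2 (begin
    2 * total a          ≡⟨ twice a ⟩
    sum (λ u → sum (λ v → 𝟙 (a u v) + 𝟙 (a v u))) ≡⟨ sum-cong-≗ (λ u → sum-cong-≗ (eq u)) ⟩
    sum (λ u → sum (λ v → 𝟙 (b u v) + 𝟙 (b v u))) ≡⟨ twice b ⟨
    2 * total b          ∎)
    where
    open ≡-Reasoning
    total : (Fin n → Fin n → Bool) → ℕ
    total a = sum (λ u → count (a u))

    twice : ∀ a → 2 * total a ≡ sum (λ u → sum (λ v → 𝟙 (a u v) + 𝟙 (a v u)))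
    twice a = begin
      2 * total a
        ≡⟨ cong (total a +_) (+-identityʳ _) ⟩
      total a + total a
        ≡⟨ cong₂ _+_ (sum-cong-≗ (λ u → count-sum (a u))) (sum-cong-≗ (λ u → count-sum (a u))) ⟩
      sum (λ u → sum (λ v → 𝟙 (a u v))) + sum (λ u → sum (λ v → 𝟙 (a u v)))
        ≡⟨ cong (sum (λ u → sum (λ v → 𝟙 (a u v))) +_) (∑-comm (λ u v → 𝟙 (a u v))) ⟩
      sum (λ u → sum (λ v → 𝟙 (a u v))) + sum (λ u → sum (λ v → 𝟙 (a v u)))
        ≡⟨ ∑-distrib-+ (λ u → sum (λ v → 𝟙 (a u v))) _ ⟨
      sum (λ u → sum (λ v → 𝟙 (a u v)) + sum (λ v → 𝟙 (a v u)))
        ≡⟨ sum-cong-≗ (λ u → sym (∑-distrib-+ (λ v → 𝟙 (a u v)) _)) ⟩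
      sum (λ u → sum (λ v → 𝟙 (a u v) + 𝟙 (a v u))) ∎

-- The number of edges of a subgraph as a finite sum

module EdgeCount where
  open Counting
  open import Data.Nat using (_+_)

  edgesAbove : ∀ {n} {G : Graph n} → Subgraph G → Fin n → ℕ
  edgesAbove H u = count (λ v → (toℕ u <ᵇ toℕ v) ∧ F H u v)

  -- The summation inside nE is local to Defs and cannot be named; total is
  -- solved by unification to be that function.
  mutual
    total : ∀ {n} {G : Graph n} → Subgraph G → (Fin n → ℕ) → ℕ
    total = _

    nE≡total : ∀ {n} {G : Graph n} (H : Subgraph G) → nE H ≡ total H (edgesAbove H)
    nE≡total H with edgesAbove H
    ... | g = refl

  -- The local summation carries a subgraph along, and the induction in `total≡sum` passes to one
  -- vertex fewer, so a subgraph on the smaller vertex set has to be supplied there.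
  edgeless : ∀ n → Graph n
  edgeless n = record { adj = λ _ _ → false ; sym = λ _ _ → refl ; irrefl = λ _ → refl }

  empty : ∀ n → Subgraph (edgeless n)
  empty n = record { S = λ _ → false ; F = λ _ _ → false ; Fsym = λ _ _ → refl ; F⊆E = λ _ _ () ; FinS = λ _ _ () }

  total≡sum : ∀ {n} {G : Graph n} (H : Subgraph G) g → total H g ≡ sum g
  total≡sum {zero} H g = refl
  total≡sum {suc n} H g = cong (g 0F +_) (total≡sum (empty n) (g ∘ Fin.suc))

  nE≡sum : ∀ {n} {G : Graph n} (H : Subgraph G) → nE H ≡ sum (edgesAbove H)
  nE≡sum H = trans (nE≡total H) (total≡sum H _)

-- Reversing arcs that enter a single vertex

module Turning {n : ℕ} {G : Graph n} where
  open Counting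
  open import Data.Nat using (_+_)
  open import Data.Nat.Properties using (+-identityʳ)

  arc⇒adj : ∀ (D : Orientation G) {u v} → arc D u v ≡ true → adj G u v ≡ true
  arc⇒adj D {u} {v} a = T⇒≡ (arc⊆adj D u v (≡⇒T a))

  adj-irrefl : ∀ {v} → adj G v v ≡ true → ∀ {A : Set} → A
  adj-irrefl {v} a = true≢false a (irrefl G v)

  adj-comm : ∀ {u v} → adj G u v ≡ true → adj G v u ≡ true
  adj-comm {u} {v} a = trans (adj-sym G v u) a

  arc-asym : ∀ (D : Orientation G) {u v} → arc D u v ≡ true → arc D v u ≡ false
  arc-asym D {u} {v} a = ¬true⇒false (λ b → oneWay D u v (≡⇒T a) (≡⇒T b))

  arc-irrefl : ∀ (D : Orientation G) v → arc D v v ≡ false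
  arc-irrefl D v = ¬true⇒false (λ a → adj-irrefl (arc⇒adj D a))

  adj⇒arc : ∀ (D : Orientation G) {u v} → adj G u v ≡ true → arc D u v ≡ true ⊎ arc D v u ≡ true
  adj⇒arc D {u} {v} a with covers D u v (≡⇒T a)
  ... | inj₁ t = inj₁ (T⇒≡ t)
  ... | inj₂ t = inj₂ (T⇒≡ t)

  module _ (D : Orientation G) (v : Fin n) (O : Fin n → Bool) where

    -- The arcs from `O` into `v` are reversed. That `O` consists of in-neighbours of `v` is assumed
    -- below, where the result has to be an orientation.
    turnArc : Fin n → Fin n → Bool
    turnArc a b =
      if is v a then arc D a b ∨ O b
      else if is v b then arc D a b ∧ not (O a)
      else arc D a b

    turn-from : ∀ b → turnArc v b ≡ arc D v b ∨ O b
    turn-from b rewrite is-refl v = refl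

    turn-off : ∀ {a b} → a ≢ v → b ≢ v → turnArc a b ≡ arc D a b
    turn-off a≢v b≢v rewrite is-≢ a≢v | is-≢ b≢v = refl

    module _ (O⊆in : ∀ a → O a ≡ true → arc D a v ≡ true) where

      ¬O-self : O v ≡ false
      ¬O-self = ¬true⇒false (λ o → true≢false (O⊆in v o) (arc-irrefl D v))

      turn : Orientation G
      turn = record { arc = turnArc ; arc⊆adj = sound ; oneWay = single ; covers = total }
        where
        sound : ∀ a b → T (turnArc a b) → T (adj G a b)
        sound a b t with a ≟ v | b ≟ v
        ... | no _ | no _ = arc⊆adj D a b t
        ... | no _ | yes refl = arc⊆adj D a v (≡⇒T (proj₁ (∧-elim (arc D a v) (T⇒≡ t))))
        ... | yes refl | _ with arc D v b in eq
        ...   | true = ≡⇒T (arc⇒adj D eq)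
        ...   | false = ≡⇒T (adj-comm (arc⇒adj D (O⊆in b (T⇒≡ t))))

        single : ∀ a b → T (turnArc a b) → ¬ T (turnArc b a)
        single a b t t′ with a ≟ v | b ≟ v
        ... | no _ | no _ = oneWay D a b t t′
        ... | yes refl | yes refl rewrite arc-irrefl D v | ¬O-self = t
        single a b t t′ | yes refl | no _ with arc D v b in eq
        ...   | true rewrite arc-asym D eq = t′
        ...   | false rewrite T⇒≡ t | ∧-zeroʳ (arc D b v) = t′
        single a b t t′ | no _ | yes refl with arc D v a in eq
        ...   | true rewrite arc-asym D eq = t
        ...   | false rewrite T⇒≡ t′ | ∧-zeroʳ (arc D a v) = t

        total : ∀ a b → T (adj G a b) → T (turnArc a b) ⊎ T (turnArc b a)
        total a b t with a ≟ v | b ≟ v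
        ... | no _ | no _ = covers D a b t
        ... | yes refl | yes refl = adj-irrefl (T⇒≡ t)
        total a b t | yes refl | no _ with covers D v b t
        ...   | inj₁ x rewrite T⇒≡ x = inj₁ _
        ...   | inj₂ x with O b in o
        ...     | true rewrite T⇒≡ x | arc-asym D (T⇒≡ x) = inj₁ _
        ...     | false rewrite T⇒≡ x = inj₂ _
        total a b t | no _ | yes refl with covers D a v t
        ...   | inj₂ x rewrite T⇒≡ x = inj₂ _
        ...   | inj₁ x with O a in o
        ...     | true rewrite T⇒≡ x | arc-asym D (T⇒≡ x) = inj₂ _
        ...     | false rewrite T⇒≡ x = inj₁ _

      outdeg-turn-self : outdeg turn v ≡ outdeg D v + count O
      outdeg-turn-self = sym (count-+ (arc D v) O (λ b → trans (disjoint b) (cong 𝟙 (sym (turn-from b)))))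
        where
        disjoint : ∀ b → 𝟙 (arc D v b) + 𝟙 (O b) ≡ 𝟙 (arc D v b ∨ O b)
        disjoint b with O b in o
        ... | true rewrite arc-asym D (O⊆in b o) = refl
        ... | false rewrite ∨-identityʳ (arc D v b) = +-identityʳ _

      -- The term `𝟙 (O w)` is the arc from `w` to `v` that is lost; the additive form avoids
      -- truncated subtraction.
      outdeg-turn-other : ∀ {w} → w ≢ v → outdeg turn w + 𝟙 (O w) ≡ outdeg D w
      outdeg-turn-other {w} w≢v =
        trans (cong (outdeg turn w +_) (sym (count-∧-is (O w) v)))
              (count-+ (turnArc w) (λ b → O w ∧ is v b) split)
        where
        split : ∀ b → 𝟙 (turnArc w b) + 𝟙 (O w ∧ is v b) ≡ 𝟙 (arc D w b)
        split b rewrite is-≢ w≢v with b ≟ v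
        split b | no _ rewrite ∧-zeroʳ (O w) = +-identityʳ _
        split b | yes refl with O w in o
        ...   | true rewrite O⊆in w o = refl
        ...   | false rewrite ∧-identityʳ (arc D w v) = +-identityʳ _

-- Hakimi's theorem: an orientation of bounded out-degree

module Hakimi {n : ℕ} (G : Graph n) where
  open Counting
  open EdgeCount
  open Turning {n} {G}
  open import Data.Nat using (_+_; _*_; _∸_; _≤_; _<_; z≤n; s≤s; s≤s⁻¹; _<?_)
  open import Data.Nat.Properties hiding (_≟_; _≤?_; _<?_)
  open import Relation.Binary using (tri<; tri≈; tri>)

  induced : (Fin n → Bool) → Subgraph G
  induced X = record
    { S = X
    ; F = λ u v → (X u ∧ X v) ∧ adj G u v
    ; Fsym = λ u v → cong₂ _∧_ (∧-comm (X u) (X v)) (adj-sym G u v)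
    ; F⊆E = λ u v t → ≡⇒T (proj₂ (∧-elim (X u ∧ X v) (T⇒≡ t)))
    ; FinS = λ u v t → ≡⇒T (proj₁ (∧-elim (X u) (proj₁ (∧-elim (X u ∧ X v) (T⇒≡ t)))))
    }

  <ᵇ-asym : ∀ {i j} → (i <ᵇ j) ≡ true → (j <ᵇ i) ≡ false
  <ᵇ-asym {i} {j} p = ¬true⇒false (λ q → <-asym (<ᵇ⇒< i j (≡⇒T p)) (<ᵇ⇒< j i (≡⇒T q)))

  <ᵇ-total : ∀ {i j : ℕ} → i ≢ j → (i <ᵇ j) ≡ true ⊎ (j <ᵇ i) ≡ true
  <ᵇ-total {i} {j} i≢j with <-cmp i j
  ... | tri< p _ _ = inj₁ (T⇒≡ (<⇒<ᵇ p))
  ... | tri≈ _ p _ = ⊥-elim (i≢j p)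
  ... | tri> _ _ p = inj₂ (T⇒≡ (<⇒<ᵇ p))

  adj⇒≢ : ∀ {u v} → adj G u v ≡ true → u ≢ v
  adj⇒≢ a refl = adj-irrefl a

  forward : Orientation G
  forward = record
    { arc = λ u v → adj G u v ∧ (toℕ u <ᵇ toℕ v)
    ; arc⊆adj = λ u v t → ≡⇒T (proj₁ (∧-elim (adj G u v) (T⇒≡ t)))
    ; oneWay = λ u v t t′ → true≢false (proj₂ (∧-elim (adj G v u) (T⇒≡ t′)))
                              (<ᵇ-asym {toℕ u} (proj₂ (∧-elim (adj G u v) (T⇒≡ t))))
    ; covers = cov
    }
    where
    cov : ∀ u v → T (adj G u v) → T (adj G u v ∧ (toℕ u <ᵇ toℕ v)) ⊎ T (adj G v u ∧ (toℕ v <ᵇ toℕ u))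
    cov u v t with <ᵇ-total {toℕ u} {toℕ v} (λ e → adj⇒≢ (T⇒≡ t) (toℕ-injective e))
    ... | inj₁ p = inj₁ (≡⇒T (∧-intro (T⇒≡ t) p))
    ... | inj₂ p = inj₂ (≡⇒T (∧-intro (adj-comm (T⇒≡ t)) p))

  OutClosed : Orientation G → (Fin n → Bool) → Set
  OutClosed D X = ∀ u v → X u ≡ true → arc D u v ≡ true → X v ≡ true

  -- Closedness keeps the head of every arc starting in `X` inside `X`, so each edge within `X` is
  -- counted once, at its tail. In `nE` it is counted once at its end of smaller index, and
  -- `double-count` compares the two.
  outdegrees-of-closed : ∀ D X → OutClosed D X →
    sum (λ u → count (λ v → X u ∧ arc D u v)) ≡ nE (induced X)
  outdegrees-of-closed D X closed =
    trans (double-count (λ u v → X u ∧ arc D u v) (λ u v → (toℕ u <ᵇ toℕ v) ∧ ((X u ∧ X v) ∧ adj G u v)) pw)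
          (sym (nE≡sum (induced X)))
    where
    ordered : ∀ (u v : Fin n) → u ≢ v → 𝟙 (toℕ u <ᵇ toℕ v) + 𝟙 (toℕ v <ᵇ toℕ u) ≡ 1
    ordered u v u≢v with <ᵇ-total {toℕ u} {toℕ v} (λ e → u≢v (toℕ-injective e))
    ... | inj₁ p rewrite p | <ᵇ-asym {toℕ u} {toℕ v} p = refl
    ... | inj₂ p rewrite p | <ᵇ-asym {toℕ v} {toℕ u} p = refl

    oriented : ∀ u v → adj G u v ≡ true → 𝟙 (arc D u v) + 𝟙 (arc D v u) ≡ 1
    oriented u v a with adj⇒arc D a
    ... | inj₁ p rewrite p | arc-asym D p = refl
    ... | inj₂ p rewrite p | arc-asym D p = refl

    nonarc : ∀ u v → adj G u v ≡ false → arc D u v ≡ false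
    nonarc u v a = ¬true⇒false (λ p → true≢false (arc⇒adj D p) a)

    leaves : ∀ u v → X u ≡ true → X v ≡ false → arc D u v ≡ false
    leaves u v xu xv = ¬true⇒false (λ p → true≢false (closed u v xu p) xv)

    pw : ∀ u v → 𝟙 (X u ∧ arc D u v) + 𝟙 (X v ∧ arc D v u)
               ≡ 𝟙 ((toℕ u <ᵇ toℕ v) ∧ ((X u ∧ X v) ∧ adj G u v)) + 𝟙 ((toℕ v <ᵇ toℕ u) ∧ ((X v ∧ X u) ∧ adj G v u))
    pw u v with adj G u v in a
    ... | false rewrite trans (adj-sym G v u) a | nonarc u v a | nonarc v u (trans (adj-sym G v u) a)
                      | ∧-zeroʳ (X u) | ∧-zeroʳ (X v) | ∧-zeroʳ (X u ∧ X v) | ∧-zeroʳ (X v ∧ X u)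
                      | ∧-zeroʳ (toℕ u <ᵇ toℕ v) | ∧-zeroʳ (toℕ v <ᵇ toℕ u) = refl
    ... | true rewrite adj-comm a with X u in xu | X v in xv
    ...   | true | true rewrite ∧-identityʳ (toℕ u <ᵇ toℕ v) | ∧-identityʳ (toℕ v <ᵇ toℕ u) =
              trans (oriented u v a) (sym (ordered u v (adj⇒≢ a)))
    ...   | true | false rewrite leaves u v xu xv | ∧-zeroʳ (toℕ u <ᵇ toℕ v) | ∧-zeroʳ (toℕ v <ᵇ toℕ u) = refl
    ...   | false | true rewrite leaves v u xv xu | ∧-zeroʳ (toℕ u <ᵇ toℕ v) | ∧-zeroʳ (toℕ v <ᵇ toℕ u) = refl
    ...   | false | false rewrite ∧-zeroʳ (toℕ u <ᵇ toℕ v) | ∧-zeroʳ (toℕ v <ᵇ toℕ u) = refl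

  -- The effect of reversing a directed path from `u` to `v` inside `X`. The path itself is not
  -- recorded, and the additive `balance` also covers the case that `u` and `v` coincide.
  record Shift (D : Orientation G) (u v : Fin n) (X : Fin n → Bool) : Set where
    field
      shifted : Orientation G
      balance : ∀ w → outdeg shifted w + 𝟙 (is u w) ≡ outdeg D w + 𝟙 (is v w)
      outside : ∀ a b → X a ≡ false ⊎ X b ≡ false → arc shifted a b ≡ arc D a b
  open Shift

  _∪_ : (Fin n → Bool) → Fin n → Fin n → Bool
  (X ∪ w) x = X x ∨ is w x

  ∨-false : ∀ a {b} → a ∨ b ≡ false → a ≡ false × b ≡ false
  ∨-false false eq = refl , eq

  widen : ∀ {D u v X} w → Shift D u v X → Shift D u v (X ∪ w)
  widen {X = X} w s = record
    { shifted = shifted s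
    ; balance = balance s
    ; outside = λ { a b (inj₁ p) → outside s a b (inj₁ (proj₁ (∨-false (X a) p)))
                  ; a b (inj₂ p) → outside s a b (inj₂ (proj₁ (∨-false (X b) p))) }
    }

  -- The arc v → w leaves X, so the shift to v has not touched it.
  extend : ∀ {D u v w X} → X u ≡ true → X v ≡ true → X w ≡ false → arc D v w ≡ true →
    Shift D u v X → Shift D u w (X ∪ w)
  extend {D} {u} {v} {w} {X} xu xv xw vw s = record
    { shifted = turn (shifted s) w (is v) v→w
    ; balance = λ x → bal x (x ≟ w)
    ; outside = out
    }
    where
    v→w : ∀ a → is v a ≡ true → arc (shifted s) a w ≡ true
    v→w a p rewrite is⇒≡ v a p = trans (outside s v w (inj₂ xw)) vw

    separate : ∀ {x y} → X x ≡ true → X y ≡ false → y ≢ x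
    separate xx xy refl = true≢false xx xy

    turned : Orientation G
    turned = turn (shifted s) w (is v) v→w

    open ≡-Reasoning

    bal-self : outdeg turned w + 𝟙 (is u w) ≡ outdeg D w + 𝟙 (is w w)
    bal-self = begin
      outdeg turned w + 𝟙 (is u w)                 ≡⟨ cong (λ b → outdeg turned w + 𝟙 b) (is-≢ (separate xu xw)) ⟩
      outdeg turned w + 0                          ≡⟨ +-identityʳ _ ⟩
      outdeg turned w                              ≡⟨ outdeg-turn-self (shifted s) w (is v) v→w ⟩
      outdeg (shifted s) w + count (is v)          ≡⟨ cong₂ _+_ unmoved (count-is v) ⟩
      outdeg D w + 1                               ≡⟨ cong (λ b → outdeg D w + 𝟙 b) (is-refl w) ⟨
      outdeg D w + 𝟙 (is w w)                      ∎
      where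
      unmoved : outdeg (shifted s) w ≡ outdeg D w
      unmoved = count-cong (λ b → outside s w b (inj₁ xw))

    bal-other : ∀ {x} → x ≢ w → outdeg turned x + 𝟙 (is u x) ≡ outdeg D x + 𝟙 (is w x)
    bal-other {x} x≢w = +-cancelʳ-≡ (𝟙 (is v x)) _ _ (begin
      outdeg turned x + 𝟙 (is u x) + 𝟙 (is v x)    ≡⟨ +-assoc (outdeg turned x) _ _ ⟩
      outdeg turned x + (𝟙 (is u x) + 𝟙 (is v x))  ≡⟨ cong (outdeg turned x +_) (+-comm (𝟙 (is u x)) _) ⟩
      outdeg turned x + (𝟙 (is v x) + 𝟙 (is u x))  ≡⟨ +-assoc (outdeg turned x) _ _ ⟨
      outdeg turned x + 𝟙 (is v x) + 𝟙 (is u x)    ≡⟨ cong (_+ 𝟙 (is u x)) (outdeg-turn-other (shifted s) w (is v) v→w x≢w) ⟩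
      outdeg (shifted s) x + 𝟙 (is u x)            ≡⟨ balance s x ⟩
      outdeg D x + 𝟙 (is v x)                      ≡⟨ cong (_+ 𝟙 (is v x)) (+-identityʳ _) ⟨
      outdeg D x + 0 + 𝟙 (is v x)                  ≡⟨ cong (λ b → outdeg D x + 𝟙 b + 𝟙 (is v x)) (is-≢ x≢w) ⟨
      outdeg D x + 𝟙 (is w x) + 𝟙 (is v x)         ∎)

    bal : ∀ x → Dec (x ≡ w) → outdeg turned x + 𝟙 (is u x) ≡ outdeg D x + 𝟙 (is w x)
    bal x (yes refl) = bal-self
    bal x (no x≢w) = bal-other x≢w

    out : ∀ a b → (X ∪ w) a ≡ false ⊎ (X ∪ w) b ≡ false → turnArc (shifted s) w (is v) a b ≡ arc D a b
    out a b (inj₁ p) with a ≟ w | b ≟ w | ∨-false (X a) p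
    ... | yes refl | _ | _ , ()
    ... | no a≢w | yes refl | xa , _ rewrite is-≢ (separate xv xa) | ∧-identityʳ (arc (shifted s) a w) = outside s a w (inj₁ xa)
    ... | no a≢w | no b≢w | xa , _ = outside s a b (inj₁ xa)
    out a b (inj₂ p) with a ≟ w | b ≟ w | ∨-false (X b) p
    ... | _ | yes refl | _ , ()
    ... | yes refl | no b≢w | xb , _ rewrite is-≢ (separate xv xb) | ∨-identityʳ (arc (shifted s) w b) = outside s w b (inj₂ xb)
    ... | no a≢w | no b≢w | xb , _ = outside s a b (inj₂ xb)

  stay : ∀ D u → Shift D u u (is u)
  stay D u = record { shifted = D ; balance = λ _ → refl ; outside = λ _ _ _ → refl }

  sum-indicator : ∀ {m} (X : Fin m → Bool) k → sum (λ v → k * 𝟙 (X v)) ≡ k * count X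
  sum-indicator {zero} X k = sym (*-zeroʳ k)
  sum-indicator {suc m} X k = trans (cong (k * 𝟙 (X 0F) +_) (sum-indicator (X ∘ Fin.suc) k)) (sym (*-distribˡ-+ k (𝟙 (X 0F)) _))

  sum-is : ∀ (u : Fin n) → sum (λ v → 𝟙 (is u v)) ≡ 1
  sum-is u = trans (sym (count-sum (is u))) (count-is u)

  module _ (k : ℕ) (sparse : ∀ X → ∃ (λ v → X v ≡ true) → nE (induced X) ≤ k * count X) where

    -- `X` consists of vertices reachable from `u`, each with its path reversal, and grows along
    -- arcs leaving it until it contains a vertex of out-degree below `k`. If it closes up first,
    -- its out-degrees are all at least `k` and that of `u` is larger, so it spans more than
    -- `k * count X` edges, against `sparse`. The bound `m` on the complement ensures termination.
    sink : ∀ D u → k < outdeg D u → ∀ m X → X u ≡ true → count (not ∘ X) ≤ m →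
      (∀ v → X v ≡ true → Shift D u v X) → ∃ λ z → outdeg D z < k × ∃ λ X′ → Shift D u z X′
    sink D u k<u m X xu le shifts with any? (λ z → (X z ≟ᵇ true) ×-dec (outdeg D z <? k))
    ... | yes (z , xz , lt) = z , lt , X , shifts z xz
    ... | no full with any? (λ v → any? (λ w → (X v ≟ᵇ true) ×-dec (arc D v w ≟ᵇ true) ×-dec (X w ≟ᵇ false)))
    sink D u k<u m X xu le shifts | no full | yes (v , w , xv , vw , xw) = continue m le
      where
      shrink : count (not ∘ (X ∪ w)) + 1 ≡ count (not ∘ X)
      shrink = trans (cong (_+ 1) (count-cong (λ x → de-morgan (X x)))) (count-∖ (not ∘ X) (cong not xw))
        where
        de-morgan : ∀ a {b} → not (a ∨ b) ≡ not a ∧ not b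
        de-morgan true = refl
        de-morgan false = refl

      next : ∀ x → (X ∪ w) x ≡ true → Shift D u x (X ∪ w)
      next x p with x ≟ w
      ... | yes refl = extend xu xv xw vw (shifts v xv)
      ... | no _ = widen w (shifts x (trans (sym (∨-identityʳ (X x))) p))

      continue : ∀ m → count (not ∘ X) ≤ m → ∃ λ z → outdeg D z < k × ∃ λ X′ → Shift D u z X′
      continue zero le = ⊥-elim (1+n≰n (≤-trans (m≤n+m 1 _) (≤-trans (≤-reflexive shrink) le)))
      continue (suc m) le = sink D u k<u m (X ∪ w) (cong (_∨ is w u) xu)
        (s≤s⁻¹ (≤-trans (≤-reflexive (trans (+-comm 1 _) shrink)) le)) next
    sink D u k<u m X xu le shifts | no full | no stuck = ⊥-elim (n≮n _ (begin-strict
      k * count X                                    <⟨ n<1+n _ ⟩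
      1 + k * count X                                ≡⟨ +-comm 1 _ ⟩
      k * count X + 1                                ≡⟨ cong₂ _+_ (sum-indicator X k) (sum-is u) ⟨
      sum (λ v → k * 𝟙 (X v)) + sum (λ v → 𝟙 (is u v)) ≡⟨ ∑-distrib-+ (λ v → k * 𝟙 (X v)) _ ⟨
      sum (λ v → k * 𝟙 (X v) + 𝟙 (is u v))           ≤⟨ sum-mono large ⟩
      sum (λ v → count (λ w → X v ∧ arc D v w))      ≡⟨ outdegrees-of-closed D X closed ⟩
      nE (induced X)                                 ≤⟨ sparse X (u , xu) ⟩
      k * count X                                    ∎))
      where
      open ≤-Reasoning
      closed : OutClosed D X
      closed v w xv vw with X w in xw
      ... | true = refl
      ... | false = ⊥-elim (stuck (v , w , xv , vw , xw))

      large : ∀ v → k * 𝟙 (X v) + 𝟙 (is u v) ≤ count (λ w → X v ∧ arc D v w)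
      large v with v ≟ u
      ... | yes refl rewrite xu | *-identityʳ k | +-comm k 1 = k<u
      ... | no _ with X v in xv
      ...   | true rewrite *-identityʳ k | +-identityʳ k = ≮⇒≥ (λ lt → full (v , xv , lt))
      ...   | false rewrite *-zeroʳ k = z≤n

    excess : Orientation G → ℕ
    excess D = sum (λ v → outdeg D v ∸ k)

    -- The excess at `u` falls by one; `z` starts below `k` and gains one arc, so its excess stays
    -- zero.
    shift-excess : ∀ D u z X (s : Shift D u z X) → k < outdeg D u → outdeg D z < k → excess (shifted s) < excess D
    shift-excess D u z X s k<u z<k = begin-strict
      excess (shifted s)                             <⟨ n<1+n _ ⟩
      1 + excess (shifted s)                         ≡⟨ +-comm 1 _ ⟩
      excess (shifted s) + 1                         ≡⟨ cong (excess (shifted s) +_) (sum-is u) ⟨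
      excess (shifted s) + sum (λ v → 𝟙 (is u v))    ≡⟨ ∑-distrib-+ (λ v → outdeg (shifted s) v ∸ k) _ ⟨
      sum (λ v → (outdeg (shifted s) v ∸ k) + 𝟙 (is u v)) ≤⟨ sum-mono pointwise ⟩
      excess D                                       ∎
      where
      open ≤-Reasoning
      u≢z : u ≢ z
      u≢z refl = <-asym k<u z<k

      pointwise : ∀ w → (outdeg (shifted s) w ∸ k) + 𝟙 (is u w) ≤ outdeg D w ∸ k
      pointwise w with balance s w
      ... | eq with w ≟ u | w ≟ z
      ... | yes refl | yes refl = ⊥-elim (u≢z refl)
      ... | yes refl | no _ rewrite +-identityʳ (outdeg D u) | sym eq =
            ≤-reflexive (sym (+-∸-comm 1 (s≤s⁻¹ (subst (k <_) (+-comm _ 1) k<u))))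
      ... | no _ | yes refl rewrite +-identityʳ (outdeg (shifted s) z) | eq
                                  | m≤n⇒m∸n≡0 (subst (_≤ k) (+-comm 1 _) z<k) = z≤n
      ... | no _ | no _ rewrite +-identityʳ (outdeg (shifted s) w) | +-identityʳ (outdeg D w) | eq | +-identityʳ (outdeg D w ∸ k) = ≤-refl

    bounded-orientation : ∃ λ D → ∀ v → outdeg D v ≤ k
    bounded-orientation = relieve (excess forward) forward ≤-refl
      where
      relieve : ∀ m D → excess D ≤ m → ∃ λ D → ∀ v → outdeg D v ≤ k
      relieve m D le with any? (λ u → k <? outdeg D u)
      ... | no none = D , λ v → ≮⇒≥ (λ lt → none (v , lt))
      relieve m D le | yes (u , k<u)
        with sink D u k<u _ (is u) (is-refl u) ≤-refl (λ { v p → subst (λ v → Shift D u v (is u)) (sym (is⇒≡ u v p)) (stay D u) })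
      ... | z , z<k , X , s with m | ≤-trans (shift-excess D u z X s k<u z<k) le
      ...   | suc m | lt = relieve m (shifted s) (s≤s⁻¹ lt)

-- Settling one vertex and its effect on potentials

module Levels {n : ℕ} {G : Graph n} (c : Fin n → Fin 3)
  (coloured : ∀ u v → adj G u v ≡ true → c u ≢ c v) (k : ℕ) where
  open Counting
  open Turning {n} {G}
  open import Data.Nat using (_+_; _∸_; _≤_; _<_; z≤n; s≤s; s≤s⁻¹; _≤?_)
  open import Data.Nat.Properties hiding (_≟_; _≤?_; _<?_)

  record State : Set where
    constructor state
    field
      orient : Orientation G
      live : Fin n → Bool
  open State

  Live Done : State → Fin n → Set
  Live s v = live s v ≡ true
  Done s v = live s v ≡ false

  out : State → Fin n → ℕ
  out s = outdeg (orient s)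

  into : State → Fin n → Fin n → Bool
  into s v w = arc (orient s) w v ∧ live s w

  pot : State → Fin n → ℕ
  pot s v = out s v + count (into s v)

  -- What survives any amount of settling. Bounds proved at one moment are carried to later ones
  -- through this relation, and the out-degrees of settled vertices are final.
  record _⊑_ (s s′ : State) : Set where
    field
      live⊆ : ∀ {v} → Live s′ v → Live s v
      pot≤ : ∀ {v} → Live s′ v → pot s′ v ≤ pot s v
      out≤ : ∀ {v} → Live s′ v → out s′ v ≤ out s v
      into⊆ : ∀ {v w} → Live s′ v → into s′ v w ≡ true → into s v w ≡ true
      out-done : ∀ {v} → Done s v → out s′ v ≡ out s v
  open _⊑_

  ⊑-refl : ∀ {s} → s ⊑ s
  ⊑-refl = record { live⊆ = λ l → l ; pot≤ = λ _ → ≤-refl ; out≤ = λ _ → ≤-refl ; into⊆ = λ _ p → p ; out-done = λ _ → refl }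

  done⊆ : ∀ {s s′} → s ⊑ s′ → ∀ {v} → Done s v → Done s′ v
  done⊆ r d = ¬true⇒false (λ l → true≢false (live⊆ r l) d)

  ⊑-trans : ∀ {s t r} → s ⊑ t → t ⊑ r → s ⊑ r
  ⊑-trans p q = record
    { live⊆ = live⊆ p ∘ live⊆ q
    ; pot≤ = λ l → ≤-trans (pot≤ q l) (pot≤ p (live⊆ q l))
    ; out≤ = λ l → ≤-trans (out≤ q l) (out≤ p (live⊆ q l))
    ; into⊆ = λ l → into⊆ p (live⊆ q l) ∘ into⊆ q l
    ; out-done = λ d → trans (out-done q (done⊆ p d)) (out-done p d)
    }

  -- K is the set of unsettled in-neighbours whose arcs into v are kept.
  module Settle (s : State) (v : Fin n) (v-live : Live s v) (d : ℕ) (out≤d : out s v ≤ d) (d≤pot : d ≤ pot s v)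
    (K : Fin n → Bool) (K⊆ : ∀ w → K w ≡ true → into s v w ≡ true) (size : count K ≡ pot s v ∸ d) where

    O : Fin n → Bool
    O w = into s v w ∧ not (K w)

    O⇒arc : ∀ w → O w ≡ true → arc (orient s) w v ≡ true
    O⇒arc w o = proj₁ (∧-elim (arc (orient s) w v) (proj₁ (∧-elim (into s v w) o)))

    settled : State
    settled = state (turn (orient s) v O O⇒arc) (live s ∖ v)

    out-settled : out settled v ≡ d
    out-settled = trans (outdeg-turn-self (orient s) v O O⇒arc) (+-cancelʳ-≡ (count K) _ _ (begin
      out s v + count O + count K   ≡⟨ +-assoc (out s v) _ _ ⟩
      out s v + (count O + count K) ≡⟨ cong (out s v +_) (trans (+-comm (count O) _) (count-+ K O part)) ⟩
      pot s v                       ≡⟨ m+[n∸m]≡n d≤pot ⟨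
      d + (pot s v ∸ d)             ≡⟨ cong (d +_) size ⟨
      d + count K                   ∎))
      where
      open ≡-Reasoning
      part : ∀ w → 𝟙 (K w) + 𝟙 (O w) ≡ 𝟙 (into s v w)
      part w with K w in k
      ... | true rewrite K⊆ w k = refl
      ... | false = cong 𝟙 (∧-identityʳ (into s v w))

    live-settled : ∀ {w} → Live settled w → Live s w × w ≢ v
    live-settled = ∖-elim (live s)

    out-change : ∀ {w} → w ≢ v → out settled w + 𝟙 (O w) ≡ out s w
    out-change = outdeg-turn-other (orient s) v O O⇒arc

    into-settled : ∀ {w} → w ≢ v → ∀ x → into settled w x ≡ (into s w ∖ v) x
    into-settled {w} w≢v x = by (x ≟ v)
      where
      by : Dec (x ≡ v) → into settled w x ≡ (into s w ∖ v) x
      by (yes refl) = trans (cong (turnArc (orient s) v O v w ∧_) (∖-self (live s) v))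
        (trans (∧-zeroʳ _) (sym (∖-self (into s w) v)))
      by (no x≢v) = trans (cong₂ _∧_ (turn-off (orient s) v O x≢v w≢v) (∖-other (live s) x≢v))
        (sym (∖-other (into s w) x≢v))

    -- There are two possible losses: an arc from `w` to `v` that is turned lowers the out-degree of
    -- `w`, and an arc from `v` to `w` stops counting because `v` is no longer unsettled. For the
    -- same reason a turned arc adds nothing to the in-neighbours counted for `w`.
    pot-change : ∀ {w} → w ≢ v → pot settled w + (𝟙 (O w) + 𝟙 (arc (orient s) v w)) ≡ pot s w
    pot-change {w} w≢v = begin
      (out settled w + count (into settled w)) + (𝟙 (O w) + 𝟙 a)   ≡⟨ interchange (out settled w) _ _ _ ⟩
      (out settled w + 𝟙 (O w)) + (count (into settled w) + 𝟙 a)   ≡⟨ cong₂ _+_ (out-change w≢v) ins ⟩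
      pot s w                                                      ∎
      where
      open ≡-Reasoning
      open import Algebra.Properties.CommutativeSemigroup +-commutativeSemigroup using (interchange)
      a : Bool
      a = arc (orient s) v w

      ins : count (into settled w) + 𝟙 a ≡ count (into s w)
      ins with a in eq
      ... | true = trans (cong (_+ 1) (count-cong (into-settled w≢v))) (count-∖ (into s w) (∧-intro eq v-live))
      ... | false = trans (+-identityʳ _) (count-cong (λ x → trans (into-settled w≢v x) (absent x)))
        where
        absent : ∀ x → (into s w ∖ v) x ≡ into s w x
        absent x with x ≟ v
        ... | yes refl rewrite eq = refl
        ... | no _ = ∧-identityʳ _

    -- The edge has one direction, and if it points to `v` it is turned because `w` is not kept; so
    -- exactly one of the two losses occurs.
    pot-drop : ∀ {w} → Live settled w → adj G v w ≡ true → K w ≡ false → suc (pot settled w) ≡ pot s w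
    pot-drop {w} l a k with live-settled l
    ... | lw , w≢v = trans (+-comm 1 _) (trans (cong (pot settled w +_) (sym one)) (pot-change w≢v))
      where
      one : 𝟙 (O w) + 𝟙 (arc (orient s) v w) ≡ 1
      one with adj⇒arc (orient s) a
      ... | inj₁ vw rewrite vw | arc-asym (orient s) vw = refl
      ... | inj₂ wv rewrite wv | lw | k | arc-asym (orient s) wv = refl

    pot-far : ∀ {w} → w ≢ v → adj G v w ≡ false → pot settled w ≡ pot s w
    pot-far {w} w≢v na = trans (sym (+-identityʳ _)) (trans (cong (pot settled w +_) (sym none)) (pot-change w≢v))
      where
      none : 𝟙 (O w) + 𝟙 (arc (orient s) v w) ≡ 0
      none rewrite ¬true⇒false (λ vw → true≢false (arc⇒adj (orient s) vw) na)
                 | ¬true⇒false (λ wv → true≢false (adj-comm (arc⇒adj (orient s) wv)) na) = refl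

    progress : s ⊑ settled
    progress = record
      { live⊆ = proj₁ ∘ live-settled
      ; pot≤ = λ l → m+n≤o⇒m≤o _ (≤-reflexive (pot-change (proj₂ (live-settled l))))
      ; out≤ = λ l → m+n≤o⇒m≤o _ (≤-reflexive (out-change (proj₂ (live-settled l))))
      ; into⊆ = λ {w} l p → proj₁ (∖-elim (into s w) (trans (sym (into-settled (proj₂ (live-settled l)) _)) p))
      ; out-done = λ {w} dw → trans (sym (+-identityʳ _)) (trans (cong (out settled w +_) (sym (no-O dw))) (out-change (other dw)))
      }
      where
      other : ∀ {w} → Done s w → w ≢ v
      other dw refl = true≢false v-live dw

      no-O : ∀ {w} → Done s w → 𝟙 (O w) ≡ 0
      no-O {w} dw rewrite dw | ∧-zeroʳ (arc (orient s) w v) = refl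

    live-count : count (live settled) + 1 ≡ count (live s)
    live-count = count-∖ (live s) v-live

  -- Sweeping one class at one value

  -- The state while vertices are settled at d. A vertex w of class i may serve as a
  -- kept in-neighbour only if its potential is below σ i; since σ also bounds all
  -- potentials, every unsettled neighbour of a vertex settled at d is then below σ.
  record Phase (d : ℕ) (σ : Fin 3 → ℕ) (s : State) : Set where
    field
      cap : ∀ {v} → Live s v → out s v ≤ d
      bound : ∀ {v} → Live s v → pot s v ≤ σ (c v)
      above : ∀ {v} → Done s v → d ≤ out s v
      below : ∀ {v} → Done s v → out s v ≤ 7 + k
      distinct : ∀ {u v} → Done s u → Done s v → adj G u v ≡ true → out s u ≢ out s v
      blocked : ∀ {u w} → Done s u → out s u ≡ d → Live s w → adj G u w ≡ true → pot s w < σ (c w)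
  open Phase

  -- Under this guarantee a class-`E` vertex of potential at least `ℓ` has no neighbour settled at
  -- `d`, so settling it there creates no conflict.
  Free : Fin 3 → ℕ → ℕ → State → Set
  Free E d ℓ s = ∀ {u v} → Done s u → out s u ≡ d → Live s v → c v ≡ E → adj G u v ≡ true → pot s v < ℓ

  avail : (Fin 3 → ℕ) → State → Fin n → Fin n → Bool
  avail σ s v w = into s v w ∧ (pot s w <ᵇ σ (c w))

  -- `stuck` lists the two reasons for which a class-`E` vertex is left over: too low a potential,
  -- or too few in-neighbours that can be kept. `same` rests on the independence of the class; it
  -- shows that a left-over vertex had its final potential already when the sweep began.
  record Swept (E : Fin 3) (d ℓ : ℕ) (σ : Fin 3 → ℕ) (s s′ : State) : Set where
    field
      later : s ⊑ s′
      phase : Phase d σ s′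
      stuck : ∀ {v} → Live s′ v → c v ≡ E → pot s′ v < ℓ ⊎ count (avail σ s′ v) < pot s′ v ∸ d
      same : ∀ {v} → Live s′ v → c v ≡ E → pot s′ v ≡ pot s v
  open Swept

  module _ (E : Fin 3) (d ℓ : ℕ) (σ : Fin 3 → ℕ) (d≤ℓ : d ≤ ℓ) (d≤7+k : d ≤ 7 + k) where

    Eligible : State → Fin n → Set
    Eligible s v = Live s v × c v ≡ E × ℓ ≤ pot s v × pot s v ∸ d ≤ count (avail σ s v)

    eligible? : ∀ s v → Dec (Eligible s v)
    eligible? s v = (live s v ≟ᵇ true) ×-dec (c v ≟ E) ×-dec (ℓ ≤? pot s v) ×-dec (pot s v ∸ d ≤? count (avail σ s v))

    -- Keeping `pot s v ∸ d` available in-neighbours gives `v` out-degree `d`. Class `E` is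
    -- independent, so `v` has no neighbour in it and `Free` persists.
    settle-one : ∀ s → Phase d σ s → Free E d ℓ s → ∃ (Eligible s) →
      ∃ λ s′ → s ⊑ s′ × Phase d σ s′ × Free E d ℓ s′ × (∀ {w} → Live s′ w → c w ≡ E → pot s′ w ≡ pot s w)
             × count (live s′) < count (live s)
    settle-one s ph free (v , v-live , cv , ℓ≤pot , enough) with sub-of-size (avail σ s v) _ enough
    ... | K , K⊆avail , size = settled , progress , phase′ , free′ , same′ , ≤-reflexive (trans (+-comm 1 _) live-count)
      where
      open Settle s v v-live d (cap ph v-live) (≤-trans d≤ℓ ℓ≤pot) K
        (λ w k → proj₁ (∧-elim (into s v w) (K⊆avail w k))) size

      apart : ∀ {w} → c w ≡ E → adj G v w ≡ true → ∀ {A : Set} → A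
      apart cw a = ⊥-elim (coloured _ _ a (trans cv (sym cw)))

      unblocked : ∀ {u} → Done s u → adj G u v ≡ true → out s u ≢ d
      unblocked du a e = n≮n _ (≤-trans (free du e v-live cv a) ℓ≤pot)

      old-or-new : ∀ {u} → Done settled u → u ≡ v ⊎ (u ≢ v × Done s u × out settled u ≡ out s u)
      old-or-new {u} du = by (u ≟ v)
        where
        by : Dec (u ≡ v) → u ≡ v ⊎ (u ≢ v × Done s u × out settled u ≡ out s u)
        by (yes p) = inj₁ p
        by (no u≢v) = inj₂ (u≢v , done , out-done progress done)
          where
          done : Done s u
          done = trans (sym (∖-other (live s) u≢v)) du

      free′ : Free E d ℓ settled
      free′ du e lw cw a with old-or-new du
      ... | inj₁ refl = apart cw a
      ... | inj₂ (_ , du′ , same) = ≤-trans (s≤s (pot≤ progress lw)) (free du′ (trans (sym same) e) (live⊆ progress lw) cw a)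

      same′ : ∀ {w} → Live settled w → c w ≡ E → pot settled w ≡ pot s w
      same′ lw cw = pot-far (proj₂ (live-settled lw)) (¬true⇒false (λ a → apart cw a))

      phase′ : Phase d σ settled
      phase′ .cap lw = ≤-trans (out≤ progress lw) (cap ph (live⊆ progress lw))
      phase′ .bound lw = ≤-trans (pot≤ progress lw) (bound ph (live⊆ progress lw))
      phase′ .above du with old-or-new du
      ... | inj₁ refl = ≤-reflexive (sym out-settled)
      ... | inj₂ (_ , du′ , same) = subst (d ≤_) (sym same) (above ph du′)
      phase′ .below du with old-or-new du
      ... | inj₁ refl = subst (_≤ 7 + k) (sym out-settled) d≤7+k
      ... | inj₂ (_ , du′ , same) = subst (_≤ 7 + k) (sym same) (below ph du′)
      phase′ .distinct du dw a e with old-or-new du | old-or-new dw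
      ... | inj₁ refl | inj₁ refl = adj-irrefl a
      ... | inj₁ refl | inj₂ (_ , dw′ , same) = unblocked dw′ (adj-comm a) (trans (sym same) (trans (sym e) out-settled))
      ... | inj₂ (_ , du′ , same) | inj₁ refl = unblocked du′ a (trans (sym same) (trans e out-settled))
      ... | inj₂ (_ , du′ , same) | inj₂ (_ , dw′ , same″) = distinct ph du′ dw′ a (trans (sym same) (trans e same″))
      phase′ .blocked {w = w} du e lw a with old-or-new du
      ... | inj₂ (_ , du′ , same) = ≤-trans (s≤s (pot≤ progress lw)) (blocked ph du′ (trans (sym same) e) (live⊆ progress lw) a)
      -- A kept in-neighbour was available, hence below `σ`. Any other unsettled neighbour had
      -- potential at most `σ` and drops by one.
      ... | inj₁ refl = by (K w) refl
        where
        by : ∀ b → K w ≡ b → pot settled w < σ (c w)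
        by true k = ≤-trans (s≤s (pot≤ progress lw)) (<ᵇ⇒< _ _ (≡⇒T (proj₂ (∧-elim (into s v w) (K⊆avail w k)))))
        by false k = ≤-trans (≤-reflexive (pot-drop lw a k)) (bound ph (live⊆ progress lw))

    sweep : ∀ s → Phase d σ s → Free E d ℓ s → ∃ (Swept E d ℓ σ s)
    sweep s ph free = loop (count (live s)) s ≤-refl ph free
      where
      loop : ∀ m s → count (live s) ≤ m → Phase d σ s → Free E d ℓ s → ∃ (Swept E d ℓ σ s)
      loop m s le ph free with any? (eligible? s)
      ... | no none = s , record { later = ⊑-refl ; phase = ph ; stuck = stop ; same = λ _ _ → refl }
        where
        stop : ∀ {v} → Live s v → c v ≡ E → pot s v < ℓ ⊎ count (avail σ s v) < pot s v ∸ d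
        stop {v} l cv with ℓ ≤? pot s v
        ... | no ¬p = inj₁ (≰⇒> ¬p)
        ... | yes p = inj₂ (≰⇒> (λ q → none (v , l , cv , p , q)))
      ... | yes el with settle-one s ph free el | m
      ...   | s′ , r , ph′ , free′ , same′ , lt | zero = ⊥-elim (n≮0 (≤-trans lt le))
      ...   | s′ , r , ph′ , free′ , same′ , lt | suc m with loop m s′ (s≤s⁻¹ (≤-trans lt le)) ph′ free′
      ...     | s″ , sw = s″ , record
                { later = ⊑-trans r (later sw)
                ; phase = phase sw
                ; stuck = stuck sw
                ; same = λ l cv → trans (same sw l cv) (same′ (live⊆ (later sw) l) cv)
                }

  -- Tools for treating several classes at one level

  ⟨_,_,_⟩ : ℕ → ℕ → ℕ → Fin 3 → ℕ
  ⟨ x , y , z ⟩ 0F = x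
  ⟨ x , y , z ⟩ 1F = y
  ⟨ x , y , z ⟩ 2F = z

  Bounded : (Fin 3 → ℕ) → State → Set
  Bounded σ s = ∀ {v} → Live s v → pot s v ≤ σ (c v)

  Below : Fin 3 → ℕ → State → Set
  Below i b s = ∀ {v} → Live s v → c v ≡ i → pot s v < b

  Fresh : ℕ → State → Set
  Fresh d s = ∀ {u} → Done s u → out s u ≢ d

  Cap : State → Set
  Cap s = ∀ {v} → Live s v → out s v ≤ k

  below-later : ∀ {i b s s′} → s ⊑ s′ → Below i b s → Below i b s′
  below-later r h l cv = ≤-trans (s≤s (pot≤ r l)) (h (live⊆ r l) cv)

  cap-later : ∀ {s s′} → s ⊑ s′ → Cap s → Cap s′
  cap-later r h l = ≤-trans (out≤ r l) (h (live⊆ r l))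

  bounded : ∀ {s x y z} → Below 0F (suc x) s → Below 1F (suc y) s → Below 2F (suc z) s → Bounded ⟨ x , y , z ⟩ s
  bounded b₀ b₁ b₂ {v} l with c v in cv
  ... | 0F = s≤s⁻¹ (b₀ l cv)
  ... | 1F = s≤s⁻¹ (b₁ l cv)
  ... | 2F = s≤s⁻¹ (b₂ l cv)

  -- Potentials are at most `n + n`, so as a value of `σ` this acts as infinity and lifts every
  -- restriction on a class.
  big : ℕ
  big = suc (n + n)

  pot-big : ∀ s v → pot s v < big
  pot-big s v = s≤s (+-mono-≤ (count≤n (arc (orient s) v)) (count≤n (into s v)))

  into-live : ∀ s v {w} → into s v w ≡ true → Live s w
  into-live s v {w} p = proj₂ (∧-elim (arc (orient s) w v) p)

  into-class : ∀ s v {w} → into s v w ≡ true → c w ≢ c v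
  into-class s v {w} p = coloured _ _ (arc⇒adj (orient s) (proj₁ (∧-elim (arc (orient s) w v) p)))

  avail-intro : ∀ σ s v {w} → into s v w ≡ true → pot s w < σ (c w) → avail σ s v w ≡ true
  avail-intro σ s v p lt = ∧-intro p (T⇒≡ (<⇒<ᵇ lt))

  -- The state before the value `d` is used. All settled values are larger, so `blocked` is vacuous
  -- on entering the level.
  record Ready (d : ℕ) (s : State) : Set where
    field
      r-cap : Cap s
      r-above : ∀ {v} → Done s v → d < out s v
      r-below : ∀ {v} → Done s v → out s v ≤ 7 + k
      r-distinct : ∀ {u v} → Done s u → Done s v → adj G u v ≡ true → out s u ≢ out s v
  open Ready

  fresh : ∀ {d s} → Ready d s → Fresh d s
  fresh r du e = n≮n _ (subst (_ <_) e (r-above r du))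

  enter : ∀ {d s} σ → Ready d s → (∀ {v} → Live s v → out s v ≤ d) → Bounded σ s → Phase d σ s
  enter σ r cp bd = record
    { cap = cp ; bound = bd ; above = <⇒≤ ∘ r-above r ; below = r-below r ; distinct = r-distinct r
    ; blocked = λ du e → ⊥-elim (fresh r du e) }

  leave : ∀ {d σ s} → Cap s → Phase (suc d) σ s → Ready d s
  leave cp ph = record { r-cap = cp ; r-above = above ph ; r-below = below ph ; r-distinct = distinct ph }

  -- The opaque blocks keep later with-abstractions from unfolding these results.
  opaque
    -- A potential of at most `σ A`, which is `d`, requires no kept arc, so no class-`A` vertex is
    -- stuck for lack of in-neighbours. Next to a vertex settled at `d`, `blocked` forces the
    -- potential below `d`, which is what `Free` demands.
    drain : ∀ A {d σ s} → σ A ≡ d → d ≤ 7 + k → Phase d σ s → ∃ λ s′ → Swept A d d σ s s′ × Below A d s′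
    drain A {d} {σ} {s} σA d≤7+k ph with sweep A d d σ ≤-refl d≤7+k s ph
      (λ du e lv cv a → subst (_ <_) (trans (cong σ cv) σA) (blocked ph du e lv a))
    ... | s′ , sw = s′ , sw , low
      where
      low : Below A d s′
      low l cv with stuck sw l cv
      ... | inj₁ lt = lt
      ... | inj₂ lt = ⊥-elim (n≮0 (≤-trans lt (≤-reflexive (m≤n⇒m∸n≡0 (subst (_ ≤_) (trans (cong σ cv) σA) (bound (phase sw) l))))))

    -- With `big` every unsettled in-neighbour is available. Out-degrees are at most `k`, hence at
    -- most `d`, so there are at least `pot s′ v ∸ d` such in-neighbours and no vertex of potential
    -- `d` or more is stuck.
    raise : ∀ E {d s} → k ≤ d → d ≤ 7 + k → Ready d s →
      ∃ λ s′ → s ⊑ s′ × Phase d (λ _ → big) s′ × Below E d s′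
    raise E {d} {s} k≤d d≤7+k r
      with sweep E d d (λ _ → big) ≤-refl d≤7+k s
             (enter _ r (λ l → ≤-trans (r-cap r l) k≤d) (λ _ → <⇒≤ (pot-big s _))) (λ du e → ⊥-elim (fresh r du e))
    ... | s′ , sw = s′ , later sw , phase sw , low
      where
      low : Below E d s′
      low {v} l cv with stuck sw l cv
      ... | inj₁ lt = lt
      ... | inj₂ lt = ⊥-elim (n≮n _ (begin-strict
        count (avail (λ _ → big) s′ v) <⟨ lt ⟩
        pot s′ v ∸ d                   ≤⟨ ∸-monoʳ-≤ (pot s′ v) (≤-trans (cap-later (later sw) (r-cap r) l) k≤d) ⟩
        pot s′ v ∸ out s′ v            ≡⟨ m+n∸m≡n (out s′ v) _ ⟩
        count (into s′ v)              ≤⟨ count-mono (λ w p → avail-intro (λ _ → big) s′ v p (pot-big s′ w)) ⟩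
        count (avail (λ _ → big) s′ v) ∎))
        where open ≤-Reasoning

  opaque
    -- A vertex of class E that is not settled in the first sweep has fewer than e
    -- in-neighbours outside the class-A vertices of potential d, and the latter
    -- are all settled in the second sweep.
    pair-level : ∀ E A d e σ {s} → σ A ≡ d → d ≤ 7 + k → k + e ≤ d → Phase d σ s → Fresh d s → Cap s →
      (∀ {v} → Live s v → c v ≡ E → pot s v ≤ d + e) →
      (∀ {v w} → Live s v → c v ≡ E → d < pot s v → into s v w ≡ true → c w ≢ E → c w ≢ A → pot s w < σ (c w)) →
      ∃ λ s′ → s ⊑ s′ × Phase d σ s′ × Below E d s′ × Below A d s′
    pair-level E A d e σ {s} σA d≤7+k k+e≤d ph fr cp potE third
      with sweep E d d σ ≤-refl d≤7+k s ph (λ du eq → ⊥-elim (fr du eq))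
    ... | s₁ , sw₁ with drain A σA d≤7+k (phase sw₁)
    ...   | s₂ , sw₂ , lowA = s₂ , ⊑-trans (later sw₁) (later sw₂) , phase sw₂ , lowE , lowA
      where
      lowE : Below E d s₂
      lowE {v} l cv with stuck sw₁ (live⊆ (later sw₂) l) cv
      ... | inj₁ lt = ≤-trans (s≤s (pot≤ (later sw₂) l)) lt
      -- The in-neighbours still unsettled were all available after the first sweep, so they number
      -- fewer than `pot s₁ v ∸ d`, which is at most `e`.
      ... | inj₂ lt = begin-strict
        out s₂ v + count (into s₂ v)       ≤⟨ +-monoʳ-≤ (out s₂ v) (count-mono remaining) ⟩
        out s₂ v + count (avail σ s₁ v)    <⟨ +-monoʳ-< (out s₂ v) lt ⟩
        out s₂ v + (pot s₁ v ∸ d)          ≤⟨ +-mono-≤ (cap-later (⊑-trans (later sw₁) (later sw₂)) cp l) small ⟩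
        k + e                              ≤⟨ k+e≤d ⟩
        d                                  ∎
        where
        open ≤-Reasoning
        l₁ : Live s₁ v
        l₁ = live⊆ (later sw₂) l

        l₀ : Live s v
        l₀ = live⊆ (later sw₁) l₁

        small : pot s₁ v ∸ d ≤ e
        small = m≤n+o⇒m∸n≤o (pot s₁ v) d (≤-trans (pot≤ (later sw₁) l₁) (potE l₀ cv))

        high : d < pot s v
        high = ≤-trans (≰⇒> (λ le → n≮0 (≤-trans lt (≤-reflexive (m≤n⇒m∸n≡0 le))))) (pot≤ (later sw₁) l₁)

        safe : ∀ w → into s₂ v w ≡ true → pot s₁ w < σ (c w)
        safe w p with c w ≟ A
        -- A class-`A` vertex left over by the second sweep kept its potential during it, so it was
        -- below `d` beforehand too.
        ... | yes refl = subst (pot s₁ w <_) (sym σA)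
                           (subst (_< d) (same sw₂ (into-live s₂ v p) refl) (lowA (into-live s₂ v p) refl))
        ... | no cw≢A = ≤-trans (s≤s (pot≤ (later sw₁) (live⊆ (later sw₂) (into-live s₂ v p))))
                          (third l₀ cv high (into⊆ (later sw₁) l₁ (into⊆ (later sw₂) l p))
                             (λ cw → into-class s₂ v p (trans cw (sym cv))) cw≢A)

        remaining : ∀ w → into s₂ v w ≡ true → avail σ s₁ v w ≡ true
        remaining w p = avail-intro σ s₁ v (into⊆ (later sw₂) l p) (safe w p)

  -- The levels from `k + 7` down to 0

  Avoids : Fin 3 → State → Fin n → Set
  Avoids i s v = ∀ {w} → into s v w ≡ true → c w ≢ i

  avoids-later : ∀ {i s s′ v} → s ⊑ s′ → Live s′ v → Avoids i s v → Avoids i s′ v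
  avoids-later r l h p = h (into⊆ r l p)

  -- A potential of at most `suc d` asks for at most one kept arc, so a single available
  -- in-neighbour would suffice.
  none-available : ∀ σ s v d → count (avail σ s v) < pot s v ∸ d → pot s v ≤ suc d → ∀ {w} → avail σ s v w ≢ true
  none-available σ s v d lt le {w} p = n≮n _ (begin-strict
    1                      ≡⟨ count-is w ⟨
    count (is w)           ≤⟨ count-mono (λ x q → trans (cong (avail σ s v) (is⇒≡ w x q)) p) ⟩
    count (avail σ s v)    <⟨ lt ⟩
    pot s v ∸ d            ≤⟨ m≤n+o⇒m∸n≤o (pot s v) d (subst (pot s v ≤_) (+-comm 1 d) le) ⟩
    1                      ∎)
    where open ≤-Reasoning

  opaque
    -- All three classes compete for the value k + 2. Class 0 gets a second chance after
    -- class 1: its vertices next to a class-1 vertex settled at k + 2 are excluded by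
    -- potential < 3 + k, the others may gain in-neighbours of small potential.
    level-k+2 : ∀ {s} → Ready (2 + k) s → Below 0F (4 + k) s → Below 1F (3 + k) s → Below 2F (3 + k) s →
      ∃ λ s′ → Ready (1 + k) s′ × Below 0F (3 + k) s′ × Below 1F (2 + k) s′ × Below 2F (2 + k) s′
             × (∀ {v} → Live s′ v → c v ≡ 0F → pot s′ v < 2 + k ⊎ Avoids 1F s′ v)
    level-k+2 {s} r b₀ b₁ b₂
      with sweep 0F (2 + k) (2 + k) ⟨ 3 + k , 2 + k , 2 + k ⟩ ≤-refl (+-monoˡ-≤ k {2} {7} (s≤s (s≤s z≤n))) s
             (enter _ r (λ l → ≤-trans (r-cap r l) (m≤n+m k 2)) (bounded {s} b₀ b₁ b₂)) (λ du e → ⊥-elim (fresh r du e))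
    ... | s₁ , sw₁ with drain 1F refl (+-monoˡ-≤ k {2} {7} (s≤s (s≤s z≤n))) (phase sw₁)
    -- The threshold `3 + k` is the value of `σ` at class 0, so `blocked` supplies `Free` although
    -- `2 + k` is already in use.
    ... | s₂ , sw₂ , low₁ with sweep 0F (2 + k) (3 + k) ⟨ 3 + k , 2 + k , 2 + k ⟩ (n≤1+n (2 + k))
             (+-monoˡ-≤ k {2} {7} (s≤s (s≤s z≤n))) s₂ (phase sw₂)
             (λ {u} {v} du e lv cv a → subst (λ i → pot s₂ v < ⟨ 3 + k , 2 + k , 2 + k ⟩ i) cv (blocked (phase sw₂) du e lv a))
    ... | s₃ , sw₃ with drain 2F refl (+-monoˡ-≤ k {2} {7} (s≤s (s≤s z≤n))) (phase sw₃)
    ... | s₄ , sw₄ , low₂ =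
      s₄ , leave cap₄ (phase sw₄) , low₀ , below-later 2⊑4 low₁ , low₂ , away
      where
      d : ℕ
      d = 2 + k

      σ : Fin 3 → ℕ
      σ = ⟨ 3 + k , 2 + k , 2 + k ⟩

      2⊑4 : s₂ ⊑ s₄
      2⊑4 = ⊑-trans (later sw₃) (later sw₄)

      0⊑2 : s ⊑ s₂
      0⊑2 = ⊑-trans (later sw₁) (later sw₂)

      cap₄ : Cap s₄
      cap₄ = cap-later (⊑-trans 0⊑2 2⊑4) (r-cap r)

      below-σ : ∀ {s v} → Phase d σ s → Live s v → c v ≡ 0F → pot s v ≤ suc d
      below-σ {s} {v} ph l cv = subst (pot s v ≤_) (cong σ cv) (bound ph l)

      away₂ : ∀ {v} → Live s₂ v → c v ≡ 0F → pot s₂ v < d ⊎ Avoids 1F s₂ v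
      away₂ {v} l cv with stuck sw₁ (live⊆ (later sw₂) l) cv
      ... | inj₁ lt = inj₁ (≤-trans (s≤s (pot≤ (later sw₂) l)) lt)
      -- A class-1 in-neighbour left over by the second sweep was below `d` already before it, so it
      -- would have been available to `v`.
      ... | inj₂ lt = inj₂ (λ {w} p cw → none-available σ s₁ v d lt (below-σ (phase sw₁) (live⊆ (later sw₂) l) cv)
        (avail-intro σ s₁ v {w} (into⊆ (later sw₂) l p)
          (subst (λ i → pot s₁ w < σ i) (sym cw)
            (subst (_< d) (same sw₂ (into-live s₂ v p) cw) (low₁ (into-live s₂ v p) cw)))))

      away : ∀ {v} → Live s₄ v → c v ≡ 0F → pot s₄ v < d ⊎ Avoids 1F s₄ v
      away l cv with away₂ (live⊆ 2⊑4 l) cv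
      ... | inj₁ lt = inj₁ (≤-trans (s≤s (pot≤ 2⊑4 l)) lt)
      ... | inj₂ av = inj₂ (avoids-later 2⊑4 l av)

      low₀ : Below 0F (3 + k) s₄
      low₀ {v} l cv with stuck sw₃ (live⊆ (later sw₄) l) cv
      ... | inj₁ lt = ≤-trans (s≤s (pot≤ (later sw₄) l)) lt
      -- Any in-neighbour that is still unsettled at the end would have been available. Hence none
      -- is left, and the potential of `v` is its out-degree.
      ... | inj₂ lt = s≤s (begin
        out s₄ v + count (into s₄ v)  ≡⟨ cong (out s₄ v +_) (count-none (λ w → ¬true⇒false (isolated w))) ⟩
        out s₄ v + 0                  ≡⟨ +-identityʳ _ ⟩
        out s₄ v                      ≤⟨ cap₄ l ⟩
        k                             ≤⟨ m≤n+m k 2 ⟩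
        2 + k                         ∎)
        where
        open ≤-Reasoning
        dead : ∀ {w} → into s₄ v w ≡ true → ¬ pot s₃ w < σ (c w)
        dead p lt′ = none-available σ s₃ v d lt (below-σ (phase sw₃) (live⊆ (later sw₄) l) cv)
          (avail-intro σ s₃ v (into⊆ (later sw₄) l p) lt′)

        isolated : ∀ w → into s₄ v w ≢ true
        isolated w p with c w in cw
        ... | 0F = into-class s₄ v p (trans cw (sym cv))
        ... | 1F = dead p (subst (λ i → pot s₃ w < σ i) (sym cw)
                     (below-later (later sw₃) low₁ (live⊆ (later sw₄) (into-live s₄ v p)) cw))
        ... | 2F = dead p (subst (λ i → pot s₃ w < σ i) (sym cw)
                     (subst (_< d) (same sw₄ (into-live s₄ v p) cw) (low₂ (into-live s₄ v p) cw)))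

  Result : Set
  Result = ∃ λ (D : Orientation G) → Proper D × (∀ v → outdeg D v ≤ 7 + k)

  -- With `σ` constantly `d` no arc is ever kept, and draining the three classes in turn brings all
  -- unsettled potentials below `d`; the next value then meets the same hypothesis.
  greedy-levels : ∀ d {s} → d ≤ k → Ready d s → (∀ {v} → Live s v → pot s v ≤ d) → Result
  greedy-levels d {s} d≤k r bd with drain 0F {σ = λ _ → d} refl d≤7+k (enter _ r (λ l → ≤-trans (m≤m+n _ _) (bd l)) bd)
    where
    d≤7+k : d ≤ 7 + k
    d≤7+k = ≤-trans d≤k (m≤n+m k 7)
  ... | s₁ , sw₁ , b₀ with drain 1F {σ = λ _ → d} refl (≤-trans d≤k (m≤n+m k 7)) (phase sw₁)
  ...   | s₂ , sw₂ , b₁ with drain 2F {σ = λ _ → d} refl (≤-trans d≤k (m≤n+m k 7)) (phase sw₂)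
  ...     | s₃ , sw₃ , b₂ = next d refl
    where
    low : ∀ {v} → Live s₃ v → pot s₃ v < d
    low {v} l with c v in cv
    ... | 0F = below-later (⊑-trans (later sw₂) (later sw₃)) b₀ l cv
    ... | 1F = below-later (later sw₃) b₁ l cv
    ... | 2F = b₂ l cv

    next : ∀ d′ → d ≡ d′ → Result
    -- No potential is below 0, so after the value 0 every vertex is settled.
    next zero refl = orient s₃ , proper , λ v → below (phase sw₃) (done v)
      where
      done : ∀ v → Done s₃ v
      done v = ¬true⇒false (λ l → n≮0 (low l))

      proper : Proper (orient s₃)
      proper u v a = distinct (phase sw₃) (done u) (done v) (T⇒≡ a)
    next (suc d′) refl = greedy-levels d′ (≤-trans (n≤1+n d′) d≤k)
      (leave (cap-later (⊑-trans (later sw₁) (⊑-trans (later sw₂) (later sw₃))) (r-cap r)) (phase sw₃))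
      (λ l → s≤s⁻¹ (low l))

  opaque
    -- Here `σ` gives class 1 no slack, so its vertices of potential `1 + k` cannot be kept. The
    -- hypothesis on `Avoids` compensates: a class-0 vertex of potential `2 + k` has no unsettled
    -- in-neighbour in class 1. With excess 1 the requirement `k + e ≤ d` is tight.
    level-k+1 : ∀ {s} → Ready (1 + k) s → Below 0F (3 + k) s → Below 1F (2 + k) s → Below 2F (2 + k) s →
      (∀ {v} → Live s v → c v ≡ 0F → pot s v < 2 + k ⊎ Avoids 1F s v) →
      ∃ λ s′ → s ⊑ s′ × Phase (1 + k) ⟨ 2 + k , 1 + k , 1 + k ⟩ s′ × Below 0F (1 + k) s′ × Below 2F (1 + k) s′
    level-k+1 {s} r b₀ b₁ b₂ away =
      pair-level 0F 2F (1 + k) 1 σ {s} refl (+-monoˡ-≤ k {1} {7} (s≤s z≤n)) (≤-reflexive (+-comm k 1))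
        (enter σ r (λ l → ≤-trans (r-cap r l) (n≤1+n k)) (bounded {s} b₀ b₁ b₂)) (fresh r) (r-cap r)
        (λ l cv → ≤-trans (s≤s⁻¹ (b₀ l cv)) (≤-reflexive (+-comm 1 (1 + k)))) third
      where
      σ : Fin 3 → ℕ
      σ = ⟨ 2 + k , 1 + k , 1 + k ⟩

      third : ∀ {v w} → Live s v → c v ≡ 0F → 1 + k < pot s v → into s v w ≡ true → c w ≢ 0F → c w ≢ 2F → pot s w < σ (c w)
      third {v} {w} l cv high p ≢0 ≢2 with away l cv
      ... | inj₁ lt = ⊥-elim (n≮n _ (≤-trans lt high))
      ... | inj₂ av with c w in cw
      ...   | 0F = ⊥-elim (≢0 refl)
      ...   | 1F = ⊥-elim (av p cw)
      ...   | 2F = ⊥-elim (≢2 refl)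

  low-levels : ∀ {s} → Ready (1 + k) s → Below 0F (3 + k) s → Below 1F (2 + k) s → Below 2F (2 + k) s →
    (∀ {v} → Live s v → c v ≡ 0F → pot s v < 2 + k ⊎ Avoids 1F s v) → Result
  low-levels {s} r b₀ b₁ b₂ away with level-k+1 {s} r b₀ b₁ b₂ away
  ... | s₁ , later₁ , ph₁ , b₀′ , b₂′ with drain 1F {1 + k} {⟨ 2 + k , 1 + k , 1 + k ⟩} {s₁} refl (+-monoˡ-≤ k {1} {7} (s≤s z≤n)) ph₁
  ...   | s₂ , sw₂ , b₁′ = greedy-levels k {s₂} ≤-refl (leave {s = s₂} (cap-later {s} {s₂} (⊑-trans later₁ (later sw₂)) (r-cap r)) (phase sw₂)) low
    where
    low : ∀ {v} → Live s₂ v → pot s₂ v ≤ k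
    low {v} l with c v in cv
    ... | 0F = s≤s⁻¹ (below-later {s = s₁} {s₂} (later sw₂) b₀′ l cv)
    ... | 1F = s≤s⁻¹ (b₁′ l cv)
    ... | 2F = s≤s⁻¹ (below-later {s = s₁} {s₂} (later sw₂) b₂′ l cv)

  below-big : ∀ i s → Below i (suc big) s
  below-big i s {v} _ _ = m≤n⇒m≤1+n (pot-big s v)

  opaque
    -- Class 1 exceeds the level by at most 2, which `pair-level` admits since `k + 2 ≤ 3 + k`.
    -- Class 0 is unrestricted, so its vertices may always be kept; its bound from the level before
    -- persists.
    level-k+3 : ∀ {s} → Ready (3 + k) s → Below 1F (6 + k) s → Below 2F (4 + k) s →
      ∃ λ s′ → s ⊑ s′ × Phase (3 + k) ⟨ big , big , 3 + k ⟩ s′ × Below 1F (3 + k) s′ × Below 2F (3 + k) s′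
    level-k+3 {s} r b₁ b₂ =
      pair-level 1F 2F (3 + k) 2 σ {s} refl (+-monoˡ-≤ k {3} {7} (s≤s (s≤s (s≤s z≤n))))
        (≤-trans (≤-reflexive (+-comm k 2)) (n≤1+n (2 + k)))
        (enter σ r (λ l → ≤-trans (r-cap r l) (m≤n+m k 3)) (bounded {s} (below-big 0F s) (below-big 1F s) b₂))
        (fresh r) (r-cap r) (λ l cv → ≤-trans (s≤s⁻¹ (b₁ l cv)) (≤-reflexive (+-comm 2 (3 + k)))) third
      where
      σ : Fin 3 → ℕ
      σ = ⟨ big , big , 3 + k ⟩

      third : ∀ {v w} → Live s v → c v ≡ 1F → 3 + k < pot s v → into s v w ≡ true → c w ≢ 1F → c w ≢ 2F → pot s w < σ (c w)
      third {w = w} _ _ _ _ ≢1 ≢2 with c w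
      ... | 0F = pot-big s w
      ... | 1F = ⊥-elim (≢1 refl)
      ... | 2F = ⊥-elim (≢2 refl)

  opaque
    -- Class 2 exceeds the level by at most 2 and class 0 not at all, so these two are paired; class
    -- 1 is the unrestricted one.
    level-k+4 : ∀ {s} → Ready (4 + k) s → Below 0F (5 + k) s → Below 2F (7 + k) s →
      ∃ λ s′ → s ⊑ s′ × Phase (4 + k) ⟨ 4 + k , big , big ⟩ s′ × Below 2F (4 + k) s′ × Below 0F (4 + k) s′
    level-k+4 {s} r b₀ b₂ =
      pair-level 2F 0F (4 + k) 2 σ {s} refl (+-monoˡ-≤ k {4} {7} (s≤s (s≤s (s≤s (s≤s z≤n)))))
        (≤-trans (≤-reflexive (+-comm k 2)) (≤-trans (n≤1+n (2 + k)) (n≤1+n (3 + k))))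
        (enter σ r (λ l → ≤-trans (r-cap r l) (m≤n+m k 4)) (bounded {s} b₀ (below-big 1F s) (below-big 2F s)))
        (fresh r) (r-cap r) (λ l cv → ≤-trans (s≤s⁻¹ (b₂ l cv)) (≤-reflexive (+-comm 2 (4 + k)))) third
      where
      σ : Fin 3 → ℕ
      σ = ⟨ 4 + k , big , big ⟩

      third : ∀ {v w} → Live s v → c v ≡ 2F → 4 + k < pot s v → into s v w ≡ true → c w ≢ 2F → c w ≢ 0F → pot s w < σ (c w)
      third {w = w} _ _ _ _ ≢2 ≢0 with c w
      ... | 0F = ⊥-elim (≢0 refl)
      ... | 1F = pot-big s w
      ... | 2F = ⊥-elim (≢2 refl)

  -- The strict bounds for classes 0, 1, 2, with `k` subtracted, run through (5, 6, 7), (4, 6, 4),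
  -- (4, 3, 3), (3, 2, 2).
  middle-levels : ∀ {s} → Ready (4 + k) s → Below 0F (5 + k) s → Below 1F (6 + k) s → Below 2F (7 + k) s → Result
  middle-levels {s} r b₀ b₁ b₂ with level-k+4 {s} r b₀ b₂
  ... | s₁ , later₁ , ph₁ , b₂′ , b₀′ with cap-later {s} {s₁} later₁ (r-cap r)
  ... | cap₁ with level-k+3 {s₁} (leave {s = s₁} cap₁ ph₁) (below-later {s = s} {s₁} later₁ b₁) b₂′
  ... | s₂ , later₂ , ph₂ , b₁′ , b₂″
    with level-k+2 {s₂} (leave {s = s₂} (cap-later {s₁} {s₂} later₂ cap₁) ph₂) (below-later {s = s₁} {s₂} later₂ b₀′) b₁′ b₂″
  ... | s₃ , r₃ , low₀ , low₁ , low₂ , away = low-levels {s₃} r₃ low₀ low₁ low₂ away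

  all-levels : (D : Orientation G) → (∀ v → outdeg D v ≤ k) → Result
  all-levels D le with raise 2F {7 + k} {state D (λ _ → true)} (m≤n+m k 7) ≤-refl
    (record { r-cap = λ _ → le _ ; r-above = λ () ; r-below = λ () ; r-distinct = λ () })
  ... | s₁ , later₁ , ph₁ , b₂ with cap-later {state D (λ _ → true)} {s₁} later₁ (λ {v} _ → le v)
  ... | cap₁ with raise 1F {6 + k} {s₁} (m≤n+m k 6) (n≤1+n (6 + k)) (leave {s = s₁} cap₁ ph₁)
  ... | s₂ , later₂ , ph₂ , b₁ with cap-later {s₁} {s₂} later₂ cap₁
  ... | cap₂ with raise 0F {5 + k} {s₂} (m≤n+m k 5) (≤-trans (n≤1+n (5 + k)) (n≤1+n (6 + k))) (leave {s = s₂} cap₂ ph₂)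
  ... | s₃ , later₃ , ph₃ , b₀ =
    middle-levels {s₃} (leave {s = s₃} (cap-later {s₂} {s₃} later₃ cap₂) ph₃) b₀
      (below-later {s = s₂} {s₃} later₃ b₁) (below-later {s = s₁} {s₃} (⊑-trans later₂ later₃) b₂)

-- Rounding half of the maximum average degree up

module Density where
  import Data.Nat as ℕ
  import Data.Nat.Properties as ℕₚ
  open import Data.Integer as ℤ using (ℤ; +_; -[1+_])
  import Data.Integer.Properties as ℤₚ
  open import Data.Integer.DivMod using ([n/d]*d≤n)
  open import Data.Rational as ℚ using (ℚ; ½; floor; ceiling; ↥_; ↧_; toℚᵘ)
  import Data.Rational.Properties as ℚₚ
  open import Data.Rational.Unnormalised as ℚᵘ using (mkℚᵘ; *≤*; *≡*; _≃_)
  import Data.Rational.Unnormalised.Properties as ℚᵘₚ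

  floor*↧≤↥ : ∀ p → floor p ℤ.* ↧ p ℤ.≤ ↥ p
  floor*↧≤↥ p@record{} = [n/d]*d≤n (↥ p) (↧ p)

  -- The ceiling of `p` is minus the floor of `ℚ.- p`, so this is the bound for the floor, negated.
  ↥≤ceiling*↧ : ∀ p → ↥ p ℤ.≤ ceiling p ℤ.* ↧ p
  ↥≤ceiling*↧ p@record{} = begin
    ↥ p                                   ≡⟨ ℤₚ.neg-involutive (↥ p) ⟨
    ℤ.- (ℤ.- ↥ p)                         ≡⟨ cong ℤ.-_ (ℚₚ.↥-neg p) ⟨
    ℤ.- (↥ (ℚ.- p))                       ≤⟨ ℤₚ.neg-mono-≤ (floor*↧≤↥ (ℚ.- p)) ⟩
    ℤ.- (floor (ℚ.- p) ℤ.* ↧ (ℚ.- p))     ≡⟨ ℤₚ.neg-distribˡ-* (floor (ℚ.- p)) (↧ (ℚ.- p)) ⟩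
    ceiling p ℤ.* ↧ (ℚ.- p)               ≡⟨ cong (ceiling p ℤ.*_) (ℚₚ.↧-neg p) ⟩
    ceiling p ℤ.* ↧ p                     ∎
    where open ℤₚ.≤-Reasoning

  -- `mkℚᵘ` takes the denominator minus one, so the denominator here is 1.
  whole : ℤ → ℚᵘ.ℚᵘ
  whole i = mkℚᵘ i 0

  ≤ceiling : ∀ p → toℚᵘ p ℚᵘ.≤ whole (ceiling p)
  ≤ceiling p@record{} = *≤* (subst (ℤ._≤ ceiling p ℤ.* ↧ p) (sym (ℤₚ.*-identityʳ (↥ p))) (↥≤ceiling*↧ p))

  toℚᵘ-ℕ : ∀ m → toℚᵘ (ℕtoℚ m) ≃ whole (+ m)
  toℚᵘ-ℕ m = ℚₚ.toℚᵘ-fromℚᵘ (whole (+ m))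

  -- Multiply by one half and replace `q * ½` by its ceiling. Unnormalised rationals keep the common
  -- factors of the products from being cancelled on the way.
  halve : ∀ q e V → ℕtoℚ (2 ℕ.* e) ℚ.≤ q ℚ.* ℕtoℚ V → + e ℤ.≤ ceiling (q ℚ.* ½) ℤ.* + V
  halve q e V le = subst₂ ℤ._≤_ (ℤₚ.*-identityʳ (+ e)) (ℤₚ.*-identityʳ _) (ℚᵘₚ.drop-*≤* (begin
    whole (+ e)                                 ≃⟨ *≡* (trans (ℤₚ.*-comm (+ e) (+ 2)) (trans (sym (ℤₚ.pos-* 2 e)) (sym (trans (ℤₚ.*-identityʳ _) (ℤₚ.*-identityʳ _))))) ⟩
    whole (+ (2 ℕ.* e)) ℚᵘ.* toℚᵘ ½             ≤⟨ ℚᵘₚ.*-monoˡ-≤-nonNeg (toℚᵘ ½) doubled ⟩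
    (toℚᵘ q ℚᵘ.* whole (+ V)) ℚᵘ.* toℚᵘ ½       ≃⟨ ℚᵘₚ.*-assoc (toℚᵘ q) (whole (+ V)) (toℚᵘ ½) ⟩
    toℚᵘ q ℚᵘ.* (whole (+ V) ℚᵘ.* toℚᵘ ½)       ≃⟨ ℚᵘₚ.*-congˡ {toℚᵘ q} (ℚᵘₚ.*-comm (whole (+ V)) (toℚᵘ ½)) ⟩
    toℚᵘ q ℚᵘ.* (toℚᵘ ½ ℚᵘ.* whole (+ V))       ≃⟨ ℚᵘₚ.*-assoc (toℚᵘ q) (toℚᵘ ½) (whole (+ V)) ⟨
    (toℚᵘ q ℚᵘ.* toℚᵘ ½) ℚᵘ.* whole (+ V)       ≃⟨ ℚᵘₚ.*-congʳ {whole (+ V)} (ℚₚ.toℚᵘ-homo-* q ½) ⟨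
    toℚᵘ (q ℚ.* ½) ℚᵘ.* whole (+ V)             ≤⟨ ℚᵘₚ.*-monoˡ-≤-nonNeg (whole (+ V)) (≤ceiling (q ℚ.* ½)) ⟩
    whole (ceiling (q ℚ.* ½)) ℚᵘ.* whole (+ V)  ∎))
    where
    open ℚᵘₚ.≤-Reasoning
    doubled : whole (+ (2 ℕ.* e)) ℚᵘ.≤ toℚᵘ q ℚᵘ.* whole (+ V)
    doubled = begin
      whole (+ (2 ℕ.* e))                       ≃⟨ toℚᵘ-ℕ (2 ℕ.* e) ⟨
      toℚᵘ (ℕtoℚ (2 ℕ.* e))                     ≤⟨ ℚₚ.toℚᵘ-mono-≤ le ⟩
      toℚᵘ (q ℚ.* ℕtoℚ V)                       ≃⟨ ℚₚ.toℚᵘ-homo-* q (ℕtoℚ V) ⟩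
      toℚᵘ q ℚᵘ.* toℚᵘ (ℕtoℚ V)                 ≃⟨ ℚᵘₚ.*-congˡ {toℚᵘ q} (toℚᵘ-ℕ V) ⟩
      toℚᵘ q ℚᵘ.* whole (+ V)                   ∎

  -- A negative multiple of a positive number cannot bound a natural number from above.
  natural : ∀ i e V → 0 ℕ.< V → + e ℤ.≤ i ℤ.* + V → ∃ λ k → i ≡ + k
  natural (+ k) _ _ _ _ = k , refl
  natural -[1+ _ ] _ (suc _) _ ()

  drop-ℤ : ∀ k e V → + e ℤ.≤ + k ℤ.* + V → e ℕ.≤ k ℕ.* V
  drop-ℤ k e V le = ℤₚ.drop‿+≤+ (subst (+ e ℤ.≤_) (sym (ℤₚ.pos-* k V)) le)

-- From the maximum average degree to the proper orientation

open import Data.Integer using (+_; _+_; _≤_; +≤+)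
open import Data.Rational using (ℚ; ½; _*_; ceiling)

theorem1p4 : (n : ℕ) (G : Graph n) → Tripartite G →
    (q : ℚ) → IsMad G q →
    Σ (Orientation G) λ D → Proper D ×
    (∀ v → + (outdeg D v) ≤ ⌈ q * ½ ⌉ + + 7)
theorem1p4 n G (c , colouring) q ((H , (v , v∈H) , _) , maximal) =
  -- The subgraph attaining the maximum has a vertex, so the ceiling cannot be negative.
  let k , ⌈q/2⌉≡k = natural ⌈ q * ½ ⌉ (nE H) (nV H) (count-pos (S H) (T⇒≡ v∈H)) (sparse H (v , v∈H))
      -- Hakimi's condition of at most `k` edges per vertex in every induced subgraph is the
      -- maximality of `q`, halved and rounded up.
      D₀ , D₀≤k = bounded-orientation k λ X (u , u∈X) →
        drop-ℤ k (nE (induced X)) (count X) (subst (λ i → + nE (induced X) ≤ i ℤ.* + count X) ⌈q/2⌉≡k (sparse (induced X) (u , ≡⇒T u∈X)))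
      D , proper , D≤7+k = Levels.all-levels c (λ u v a → colouring u v (≡⇒T a)) k D₀ D₀≤k
  in D , proper , λ u → subst (λ i → + outdeg D u ≤ i + + 7) (sym ⌈q/2⌉≡k)
       (+≤+ (subst (outdeg D u ℕ.≤_) (+-comm 7 k) (D≤7+k u)))
  where
  import Data.Integer as ℤ
  import Data.Nat as ℕ
  open import Data.Nat.Properties using (+-comm)
  open Counting
  open Density
  open Hakimi G

  sparse : ∀ (H : Subgraph G) → Nonempty H → + nE H ≤ ⌈ q * ½ ⌉ ℤ.* + nV H
  sparse H H≢∅ = halve q (nE H) (nV H) (maximal H H≢∅)
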